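{- Let $F$ be a finite nonempty connected linear $s$-uniform hypergraph whose line graph is a cograph. Suppose $R_s(F)=d$ with $0<d\le s-1$ and that $\operatorname{Comp}(s,d)$ holds. Suppose further that there are an affine plane $\Pi$ of order $s$ and an integer $h$, $1\le h\le d$, such that $F\subseteq\Pi$, $F$ contains every line in $s+1-h$ parallel classes of $\Pi$ (the full parallel classes), and $F$ contains exactly $d-h$ additional lines from the remaining $h$ classes (the partial-direction lines). Then $$|V(F)|=s^2,\qquad \operatorname{rank}N(F)=1+(s+1-h)(s-1)+(d-h),\qquad C(F)=hs-d,$$ and $$(s+1)|V(F)|-s|E(F)|=s\bigl((s+1)h-d\bigr).$$ Every partial-direction row has leverage $1$, while every row in a full parallel class has leverage $$1-\frac{s-h}{s(s+1-h)}.$$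
   Context: A hypergraph is $s$-uniform if every edge has exactly $s$ vertices, and linear if any two distinct edges share at most one vertex. The line graph has the edges of the hypergraph as vertices, two distinct edges being adjacent when they intersect. A cograph is a graph with no induced path on four vertices. Connected hypergraphs have connected line graph and no isolated vertices. $N(F)$ is the edge--vertex incidence matrix (rows indexed by edges; isolated vertices removed); ranks are over $\mathbb R$. Define $$R_s(F)=(s+1)\operatorname{rank}N(F)-s|E(F)|,\qquad C(F)=|V^+(F)|-\operatorname{rank}N(F),$$ where $V^+(F)$ is the set of nonisolated vertices. The row leverage of $e\in E(F)$ is $\ell_F(e)=(P_F)_{ee}$, where $P_F=N(F)N(F)^\dagger$ is the orthogonal projector of $\mathbb R^{E(F)}$ onto the column space of $N(F)$. An $a$-net of order $s$ is a linear $s$-uniform incidence structure on $s^2$ points whose lines are divided into $a$ parallel classes; each class consists of $s$ disjoint lines partitioning the point set, and lines from different classes meet in exactly one point. Its deficiency is $s+1-a$. An affine plane of order $s$ is an $(s+1)$-net of order $s$. $F\subseteq\Pi$ means that every edge of $F$ is a line of $\Pi$. Completion hypothesis: for $0\le d\le s-1$, $\operatorname{Comp}(s,d)$ means that (i) every net of order $s$ and deficiency at most $d$ embeds in an affine plane of order $s$ (on the same point set, its parallel classes being parallel classes of the plane), and (ii) $s>(d-1)^2$. -}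

module Defs where

open import Algebra.Bundles using (CommutativeRing)
import Algebra.Definitions.RawMonoid as RawMonoidDefs
import Algebra.Properties.Ring as RingProperties
import Algebra.Properties.Semiring.Sum as SemiringSum
open import Data.Bool.Base using (if_then_else_)
import Data.Bool.Properties as Bool
open import Data.Fin.Base using (Fin; zero; suc; toℕ)
open import Data.Fin.Properties using (any?; all?)
open import Data.Fin.Subset
  using (Subset; inside; outside; _∈_; _⊆_; _∩_; Nonempty; Empty; ∣_∣)
open import Data.Fin.Subset.Properties using (_∈?_)
open import Data.Integer.Base as ℤ using (ℤ; +_; 1ℤ)
open import Data.Nat.Base as ℕ using (ℕ; zero; suc)
open import Data.Product.Base using (∃; ∃-syntax; Σ-syntax; _×_; _,_; proj₁; proj₂)
open import Data.Sum.Base using (_⊎_; inj₁; inj₂)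
open import Data.Vec.Base using ([]; _∷_; tabulate)
import Data.Vec.Properties as Vec
open import Data.Vec.Functional using (Vector)
open import Function.Base using (flip)
open import Function.Bundles using (_⇔_)
open import Function.Definitions using (Injective)
open import Level as Level using (Level; _⊔_)
open import Relation.Binary.Construct.Closure.ReflexiveTransitive using (Star)
open import Relation.Binary.Core using (Rel)
open import Relation.Binary.PropositionalEquality.Core using (_≡_; _≢_)
import Relation.Binary.Reasoning.Setoid as SetoidReasoning
open import Relation.Binary.Structures using (IsDecTotalOrder)
open import Relation.Nullary using (¬_; yes; no; does)
open import Relation.Nullary.Decidable using (_×-dec_)
open import Relation.Unary using (Pred; Decidable)

private
  variable
    a ℓ : Level
    n : ℕ

-- The library has no real numbers.  Linear algebra is done over an arbitrary
-- ordered field; ℝ, with classical logic and 0 ⁻¹ = 0, is an instance.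
record OrderedField c ℓ₁ ℓ₂ : Set (Level.suc (c ⊔ ℓ₁ ⊔ ℓ₂)) where
  field
    commutativeRing : CommutativeRing c ℓ₁
  open CommutativeRing commutativeRing public hiding (zero)
  infix  4 _≤_
  infix  8 _⁻¹
  infixl 7 _/_
  field
    _≤_             : Rel Carrier ℓ₂
    isDecTotalOrder : IsDecTotalOrder _≈_ _≤_
    0≉1             : ¬ (0# ≈ 1#)
    _⁻¹             : Carrier → Carrier
    ⁻¹-cong         : ∀ {x y} → x ≈ y → x ⁻¹ ≈ y ⁻¹
    ⁻¹-inverse      : ∀ {x} → ¬ (x ≈ 0#) → x * x ⁻¹ ≈ 1#
    +-monoˡ-≤       : ∀ {x y} z → x ≤ y → x + z ≤ y + z
    *-nonNeg        : ∀ {x y} → 0# ≤ x → 0# ≤ y → 0# ≤ x * y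

  open IsDecTotalOrder isDecTotalOrder public
    using (_≟_; _≤?_; ≤-respˡ-≈; ≤-respʳ-≈)
    renaming (refl to ≤-refl; trans to ≤-trans; antisym to ≤-antisym; total to ≤-total)

  _/_ : Carrier → Carrier → Carrier
  x / y = x * y ⁻¹

  fromℕ : ℕ → Carrier
  fromℕ k = RawMonoidDefs._×_ +-rawMonoid k 1#

module _ {c ℓ₁ ℓ₂} (K : OrderedField c ℓ₁ ℓ₂) where

  open OrderedField K
  open SemiringSum semiring
    using (sum; sum-syntax; sum-cong-≋; ∑-distrib-+; ∑-comm; *-distribˡ-sum; *-distribʳ-sum; sum-replicate-zero)

  Matrix : ℕ → ℕ → Set c
  Matrix m n = Fin m → Fin n → Carrier

  infix  4 _≋_
  infixl 7 _⊡_
  infix  9 _ᵀ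

  _≋_ : ∀ {m n} → Rel (Matrix m n) ℓ₁
  A ≋ B = ∀ i j → A i j ≈ B i j

  _⊡_ : ∀ {m n p} → Matrix m n → Matrix n p → Matrix m p
  (A ⊡ B) i j = ∑[ k < _ ] (A i k * B k j)

  _ᵀ : ∀ {m n} → Matrix m n → Matrix n m
  A ᵀ = flip A

  IsSymmetric : Matrix n n → Set ℓ₁
  IsSymmetric A = A ᵀ ≋ A

  LinearlyIndependent : ∀ {m r} → (Fin r → Vector Carrier m) → Set (c ⊔ ℓ₁)
  LinearlyIndependent {r = r} b =
    ∀ (x : Vector Carrier r) → (∀ i → ∑[ k < r ] (x k * b k i) ≈ 0#) → ∀ k → x k ≈ 0#

  InSpan : ∀ {m r} → (Fin r → Vector Carrier m) → Vector Carrier m → Set (c ⊔ ℓ₁)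
  InSpan {r = r} b v = Σ[ x ∈ Vector Carrier r ] (∀ i → v i ≈ ∑[ k < r ] (x k * b k i))

  -- The column space of A has a basis with r elements; the rows of A ᵀ are
  -- the columns of A.
  record IsRank {m n} (A : Matrix m n) (r : ℕ) : Set (c ⊔ ℓ₁) where
    field
      basis             : Fin r → Vector Carrier m
      basis-independent : LinearlyIndependent basis
      basis⊆columnSpace : ∀ k → InSpan (A ᵀ) (basis k)
      columns⊆span      : ∀ j → InSpan basis ((A ᵀ) j)

  record IsMoorePenroseInverse {m n} (A : Matrix m n) (X : Matrix n m) : Set ℓ₁ where
    field
      AXA≋A        : A ⊡ X ⊡ A ≋ A
      XAX≋X        : X ⊡ A ⊡ X ≋ X
      AX-symmetric : IsSymmetric (A ⊡ X)
      XA-symmetric : IsSymmetric (X ⊡ A)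

  module LinearAlgebraProperties where

    open RingProperties ring
    open SetoidReasoning setoid

    dot : Vector Carrier n → Vector Carrier n → Carrier
    dot x y = sum (λ i → x i * y i)

    -- The lengths are explicit because Agda cannot recover them by
    -- unification.

    ∑-cong : ∀ n {x y : Vector Carrier n} → (∀ i → x i ≈ y i) → sum x ≈ sum y
    ∑-cong n {x} {y} = sum-cong-≋ {n} {x} {y}

    ∑-zero : ∀ n {x : Vector Carrier n} → (∀ i → x i ≈ 0#) → sum x ≈ 0#
    ∑-zero n x≈0 = trans (∑-cong n x≈0) (sum-replicate-zero n)

    ∑-+ : ∀ n (x y : Vector Carrier n) → sum (λ i → x i + y i) ≈ sum x + sum y
    ∑-+ n = ∑-distrib-+ {n}

    ∑-*ˡ : ∀ n a (x : Vector Carrier n) → a * sum x ≈ sum (λ i → a * x i)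
    ∑-*ˡ n = *-distribˡ-sum {n}

    ∑-*ʳ : ∀ n a (x : Vector Carrier n) → sum x * a ≈ sum (λ i → x i * a)
    ∑-*ʳ n = *-distribʳ-sum {n}

    ∑-assoc : ∀ {m n} (x : Vector Carrier m) (C : Matrix m n) (y : Vector Carrier n) →
              dot x (λ j → dot (C j) y) ≈ dot (λ k → dot x ((C ᵀ) k)) y
    ∑-assoc {m} {n} x C y = begin
      sum (λ j → x j * sum (λ k → C j k * y k))   ≈⟨ ∑-cong m (λ j → ∑-*ˡ n (x j) (λ k → C j k * y k)) ⟩
      sum (λ j → sum (λ k → x j * (C j k * y k))) ≈⟨ ∑-comm {m} {n} (λ j k → x j * (C j k * y k)) ⟩
      sum (λ k → sum (λ j → x j * (C j k * y k))) ≈⟨ ∑-cong n (λ k → ∑-cong m (λ j → sym (*-assoc (x j) (C j k) (y k)))) ⟩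
      sum (λ k → sum (λ j → x j * C j k * y k))   ≈⟨ ∑-cong n (λ k → sym (∑-*ʳ m (y k) (λ j → x j * C j k))) ⟩
      sum (λ k → sum (λ j → x j * C j k) * y k)   ∎

    ⊡-assoc : ∀ {m n p q} (A : Matrix m n) (B : Matrix n p) (C : Matrix p q) →
              A ⊡ B ⊡ C ≋ A ⊡ (B ⊡ C)
    ⊡-assoc A B C i l = sym (∑-assoc (A i) B (λ k → C k l))

    ⊡-congˡ : ∀ {m n p} (A : Matrix m n) {B C : Matrix n p} → B ≋ C → A ⊡ B ≋ A ⊡ C
    ⊡-congˡ {n = n} A B≋C i j = ∑-cong n (λ k → *-congˡ (B≋C k j))

    ⊡-congʳ : ∀ {m n p} {A B : Matrix m n} (C : Matrix n p) → A ≋ B → A ⊡ C ≋ B ⊡ C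
    ⊡-congʳ {n = n} C A≋B i j = ∑-cong n (λ k → *-congʳ (A≋B i k))

    ⊡-ᵀ : ∀ {m n p} (A : Matrix m n) (B : Matrix n p) → (A ⊡ B) ᵀ ≋ B ᵀ ⊡ A ᵀ
    ⊡-ᵀ {n = n} A B i j = ∑-cong n (λ k → *-comm (A j k) (B k i))

    dot-comm : (x y : Vector Carrier n) → dot x y ≈ dot y x
    dot-comm {n} x y = ∑-cong n (λ i → *-comm (x i) (y i))

    ∑-neg : (x : Vector Carrier n) → sum (λ i → - x i) ≈ - sum x
    ∑-neg {n} x = begin
      sum (λ i → - x i)          ≈⟨ ∑-cong n (λ i → sym (-1*x≈-x (x i))) ⟩
      sum (λ i → - 1# * x i)     ≈⟨ sym (∑-*ˡ n (- 1#) x) ⟩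
      - 1# * sum x               ≈⟨ -1*x≈-x _ ⟩
      - sum x                    ∎

    0≤-x : ∀ {x} → x ≤ 0# → 0# ≤ - x
    0≤-x {x} x≤0 = ≤-respʳ-≈ (+-identityˡ _) (≤-respˡ-≈ (-‿inverseʳ x) (+-monoˡ-≤ (- x) x≤0))

    square-nonNeg : ∀ x → 0# ≤ x * x
    square-nonNeg x with ≤-total 0# x
    ... | inj₁ 0≤x = *-nonNeg 0≤x 0≤x
    ... | inj₂ x≤0 = ≤-respʳ-≈ -x*-x≈x*x (*-nonNeg (0≤-x x≤0) (0≤-x x≤0))
      where
      -x*-x≈x*x : - x * - x ≈ x * x
      -x*-x≈x*x = begin
        - x * - x     ≈⟨ sym (-‿distribˡ-* x (- x)) ⟩
        - (x * - x)   ≈⟨ -‿cong (sym (-‿distribʳ-* x x)) ⟩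
        - - (x * x)   ≈⟨ -‿involutive _ ⟩
        x * x         ∎

    +-nonNeg : ∀ {x y} → 0# ≤ x → 0# ≤ y → 0# ≤ x + y
    +-nonNeg {x} {y} 0≤x 0≤y = ≤-trans 0≤y (≤-respˡ-≈ (+-identityˡ y) (+-monoˡ-≤ y 0≤x))

    nonNeg-+≈0 : ∀ {x y} → 0# ≤ x → 0# ≤ y → x + y ≈ 0# → x ≈ 0#
    nonNeg-+≈0 {x} {y} 0≤x 0≤y x+y≈0 =
      ≤-antisym (≤-respʳ-≈ (trans (+-comm y x) x+y≈0) (≤-respˡ-≈ (+-identityˡ x) (+-monoˡ-≤ x 0≤y))) 0≤x

    x*y≈0⇒x≈0 : ∀ {x y} → ¬ (y ≈ 0#) → x * y ≈ 0# → x ≈ 0#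
    x*y≈0⇒x≈0 {x} {y} y≉0 xy≈0 = begin
      x                ≈⟨ sym (*-identityʳ x) ⟩
      x * 1#           ≈⟨ *-congˡ (sym (⁻¹-inverse y≉0)) ⟩
      x * (y * y ⁻¹)   ≈⟨ sym (*-assoc _ _ _) ⟩
      x * y * y ⁻¹     ≈⟨ *-congʳ xy≈0 ⟩
      0# * y ⁻¹        ≈⟨ zeroˡ _ ⟩
      0#               ∎

    square≈0 : ∀ x → x * x ≈ 0# → x ≈ 0#
    square≈0 x x²≈0 with x ≟ 0#
    ... | yes x≈0 = x≈0
    ... | no  x≉0 = x*y≈0⇒x≈0 x≉0 x²≈0

    dot-nonNeg : (u : Vector Carrier n) → 0# ≤ dot u u
    dot-nonNeg {zero}  u = ≤-refl
    dot-nonNeg {suc n} u = +-nonNeg (square-nonNeg (u zero)) (dot-nonNeg (λ i → u (suc i)))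

    dot≈0 : (u : Vector Carrier n) → dot u u ≈ 0# → ∀ i → u i ≈ 0#
    dot≈0 u uu≈0 zero =
      square≈0 _ (nonNeg-+≈0 (square-nonNeg (u zero)) (dot-nonNeg (λ i → u (suc i))) uu≈0)
    dot≈0 u uu≈0 (suc i) = dot≈0 (λ i → u (suc i))
      (nonNeg-+≈0 (dot-nonNeg (λ i → u (suc i))) (square-nonNeg (u zero)) (trans (+-comm _ _) uu≈0)) i

    -- A matrix X such that A ⊡ X is the orthogonal projector onto the
    -- column space of A, by induction on the number of columns: a new
    -- column v contributes its residual u.

    IsLeastSquares : ∀ {m n} → Matrix m n → Matrix n m → Set ℓ₁
    IsLeastSquares A X = (A ⊡ X ⊡ A ≋ A) × IsSymmetric (A ⊡ X)

    module Residual {m n} (A : Matrix m n) (X : Matrix n m) (ls : IsLeastSquares A X)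
                    (v : Vector Carrier m) where

      P : Matrix m m
      P = A ⊡ X

      z : Vector Carrier n
      z k = dot (X k) v

      Az : Vector Carrier m
      Az i = dot (A i) z

      u : Vector Carrier m
      u i = v i - Az i

      v≈u+Az : ∀ i → v i ≈ u i + Az i
      v≈u+Az i = sym (begin
        (v i - Az i) + Az i       ≈⟨ +-assoc _ _ _ ⟩
        v i + (- Az i + Az i)     ≈⟨ +-congˡ (-‿inverseˡ _) ⟩
        v i + 0#                  ≈⟨ +-identityʳ _ ⟩
        v i                       ∎)

      Az≈Pv : ∀ i → Az i ≈ dot (P i) v
      Az≈Pv i = ∑-assoc (A i) X v

      Az∙A : ∀ l → dot Az ((A ᵀ) l) ≈ dot v ((A ᵀ) l)
      Az∙A l = begin
        dot Az ((A ᵀ) l)                    ≈⟨ dot-comm Az _ ⟩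
        dot ((A ᵀ) l) Az                    ≈⟨ ∑-cong m (λ i → *-congˡ (Az≈Pv i)) ⟩
        dot ((A ᵀ) l) (λ i → dot (P i) v)   ≈⟨ ∑-assoc ((A ᵀ) l) P v ⟩
        dot (λ k → dot ((A ᵀ) l) ((P ᵀ) k)) v ≈⟨ ∑-cong m (λ k → *-congʳ (step k)) ⟩
        dot ((A ᵀ) l) v                     ≈⟨ dot-comm _ v ⟩
        dot v ((A ᵀ) l)                     ∎
        where
        step : ∀ k → dot ((A ᵀ) l) ((P ᵀ) k) ≈ A k l
        step k = begin
          dot ((A ᵀ) l) ((P ᵀ) k)  ≈⟨ ∑-cong m (λ i → trans (*-comm _ _) (*-congʳ (proj₂ ls k i))) ⟩
          dot (P k) ((A ᵀ) l)      ≈⟨ proj₁ ls k l ⟩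
          A k l                    ∎

      u∙A≈0 : ∀ l → dot u ((A ᵀ) l) ≈ 0#
      u∙A≈0 l = begin
        sum (λ i → (v i - Az i) * A i l)                  ≈⟨ ∑-cong m (λ i → trans (distribʳ _ _ _) (+-congˡ (sym (-‿distribˡ-* _ _)))) ⟩
        sum (λ i → v i * A i l + - (Az i * A i l))        ≈⟨ ∑-+ m _ _ ⟩
        dot v ((A ᵀ) l) + sum (λ i → - (Az i * A i l))    ≈⟨ +-congˡ (∑-neg (λ i → Az i * A i l)) ⟩
        dot v ((A ᵀ) l) - dot Az ((A ᵀ) l)                ≈⟨ +-congˡ (-‿cong (Az∙A l)) ⟩
        dot v ((A ᵀ) l) - dot v ((A ᵀ) l)                 ≈⟨ -‿inverseʳ _ ⟩
        0#                                                ∎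

      u∙span≈0 : ∀ (x : Vector Carrier n) → dot u (λ i → dot (A i) x) ≈ 0#
      u∙span≈0 x = trans (∑-assoc u A x) (∑-zero n (λ k → trans (*-congʳ (u∙A≈0 k)) (zeroˡ _)))

      u∙v≈u∙u : dot u v ≈ dot u u
      u∙v≈u∙u = begin
        dot u v                                    ≈⟨ ∑-cong m (λ i → trans (*-congˡ (v≈u+Az i)) (distribˡ _ _ _)) ⟩
        sum (λ i → u i * u i + u i * Az i)         ≈⟨ ∑-+ m _ _ ⟩
        dot u u + dot u Az                         ≈⟨ +-congˡ (u∙span≈0 z) ⟩
        dot u u + 0#                               ≈⟨ +-identityʳ _ ⟩
        dot u u                                    ∎

    module Extend {m n} (B : Matrix m (suc n)) where

      v : Vector Carrier m
      v i = B i zero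

      A : Matrix m n
      A i k = B i (suc k)

    leastSquares : ∀ {m} n (B : Matrix m n) → ∃ (IsLeastSquares B)
    leastSquares zero    B = (λ ()) , (λ _ ()) , (λ _ _ → refl)
    leastSquares {m} (suc n) B with leastSquares n (Extend.A B)
    ... | X , ls with all? (λ i → Residual.u (Extend.A B) X ls (Extend.v B) i ≟ 0#)
    ...   | yes u≈0 = Y , YA , Y-sym
      where
      open Extend B
      open Residual A X ls v
      Y : Matrix (suc n) m
      Y zero    j = 0#
      Y (suc k) j = X k j
      BY≋P : B ⊡ Y ≋ P
      BY≋P i j = trans (+-congʳ (zeroʳ _)) (+-identityˡ _)
      YA : B ⊡ Y ⊡ B ≋ B
      YA i zero = begin
        dot ((B ⊡ Y) i) v    ≈⟨ ∑-cong m (λ k → *-congʳ (BY≋P i k)) ⟩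
        dot (P i) v          ≈⟨ sym (Az≈Pv i) ⟩
        Az i                 ≈⟨ sym (+-identityˡ _) ⟩
        0# + Az i            ≈⟨ +-congʳ (sym (u≈0 i)) ⟩
        u i + Az i           ≈⟨ sym (v≈u+Az i) ⟩
        v i                  ∎
      YA i (suc l) = trans (∑-cong m (λ k → *-congʳ (BY≋P i k))) (proj₁ ls i l)
      Y-sym : IsSymmetric (B ⊡ Y)
      Y-sym i j = trans (BY≋P j i) (trans (proj₂ ls i j) (sym (BY≋P i j)))
    ...   | no ¬u≈0 = Y , YA , Y-sym
      where
      open Extend B
      open Residual A X ls v
      uu≉0 : ¬ (dot u u ≈ 0#)
      uu≉0 uu≈0 = ¬u≈0 (dot≈0 u uu≈0)
      w : Vector Carrier m
      w j = u j * dot u u ⁻¹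
      Y : Matrix (suc n) m
      Y zero    j = w j
      Y (suc k) j = X k j - z k * w j
      BY≋ : ∀ i j → (B ⊡ Y) i j ≈ P i j + u i * w j
      BY≋ i j = begin
        v i * w j + sum (λ k → A i k * (X k j - z k * w j))
          ≈⟨ +-congˡ (∑-cong n (λ k → trans (distribˡ _ _ _)
               (+-congˡ (trans (sym (-‿distribʳ-* _ _)) (-‿cong (sym (*-assoc _ _ _))))))) ⟩
        v i * w j + sum (λ k → A i k * X k j + - (A i k * z k * w j))
          ≈⟨ +-congˡ (trans (∑-+ n (λ k → A i k * X k j) (λ k → - (A i k * z k * w j))) (+-congˡ (trans (∑-neg (λ k → A i k * z k * w j)) (-‿cong (sym (∑-*ʳ n (w j) (λ k → A i k * z k))))))) ⟩
        v i * w j + (P i j + - (Az i * w j))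
          ≈⟨ trans (sym (+-assoc _ _ _)) (trans (+-congʳ (+-comm _ _)) (+-assoc _ _ _)) ⟩
        P i j + (v i * w j + - (Az i * w j))
          ≈⟨ +-congˡ (trans (+-congˡ (-‿distribˡ-* _ _)) (sym (distribʳ _ _ _))) ⟩
        P i j + u i * w j ∎
      w∙≈ : ∀ x → dot w x ≈ dot u x * dot u u ⁻¹
      w∙≈ x = trans (∑-cong m (λ k → trans (*-assoc _ _ _) (trans (*-congˡ (*-comm _ _)) (sym (*-assoc _ _ _)))))
                    (sym (∑-*ʳ m (dot u u ⁻¹) (λ k → u k * x k)))
      BYx≈ : ∀ i x → dot ((B ⊡ Y) i) x ≈ dot (P i) x + u i * (dot u x * dot u u ⁻¹)
      BYx≈ i x = begin
        dot ((B ⊡ Y) i) x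
          ≈⟨ ∑-cong m (λ k → trans (*-congʳ (BY≋ i k)) (trans (distribʳ _ _ _) (+-congˡ (*-assoc _ _ _)))) ⟩
        sum (λ k → P i k * x k + u i * (w k * x k))
          ≈⟨ trans (∑-+ m (λ k → P i k * x k) (λ k → u i * (w k * x k))) (+-congˡ (sym (∑-*ˡ m (u i) (λ k → w k * x k)))) ⟩
        dot (P i) x + u i * dot w x
          ≈⟨ +-congˡ (*-congˡ (w∙≈ x)) ⟩
        dot (P i) x + u i * (dot u x * dot u u ⁻¹) ∎
      YA : B ⊡ Y ⊡ B ≋ B
      YA i zero = begin
        dot ((B ⊡ Y) i) v                                ≈⟨ BYx≈ i v ⟩
        dot (P i) v + u i * (dot u v * dot u u ⁻¹)
          ≈⟨ +-cong (sym (Az≈Pv i)) (*-congˡ (trans (*-congʳ u∙v≈u∙u) (⁻¹-inverse uu≉0))) ⟩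
        Az i + u i * 1#                                  ≈⟨ trans (+-congˡ (*-identityʳ _)) (+-comm _ _) ⟩
        u i + Az i                                       ≈⟨ sym (v≈u+Az i) ⟩
        v i                                              ∎
      YA i (suc l) = begin
        dot ((B ⊡ Y) i) ((A ᵀ) l)                        ≈⟨ BYx≈ i _ ⟩
        dot (P i) ((A ᵀ) l) + u i * (dot u ((A ᵀ) l) * dot u u ⁻¹)
          ≈⟨ +-cong (proj₁ ls i l) (*-congˡ (trans (*-congʳ (u∙A≈0 l)) (zeroˡ _))) ⟩
        A i l + u i * 0#                                 ≈⟨ trans (+-congˡ (zeroʳ _)) (+-identityʳ _) ⟩
        A i l                                            ∎
      Y-sym : IsSymmetric (B ⊡ Y)
      Y-sym i j = begin
        (B ⊡ Y) j i           ≈⟨ BY≋ j i ⟩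
        P j i + u j * w i     ≈⟨ +-cong (proj₂ ls i j)
                                  (trans (sym (*-assoc _ _ _)) (trans (*-congʳ (*-comm _ _)) (*-assoc _ _ _))) ⟩
        P i j + u i * w j     ≈⟨ sym (BY≋ i j) ⟩
        (B ⊡ Y) i j           ∎

    InSpan-trans : ∀ {m r q} {a : Fin q → Vector Carrier m} {b : Fin r → Vector Carrier m} {x} →
                   (∀ j → InSpan b (a j)) → InSpan a x → InSpan b x
    InSpan-trans {q = q} {b = b} a⊆b (y , x≈) =
      (λ k → sum (λ j → y j * proj₁ (a⊆b j) k)) ,
      λ i → trans (x≈ i) (trans (∑-cong q (λ j → *-congˡ (proj₂ (a⊆b j) i)))
                                (∑-assoc y (λ j → proj₁ (a⊆b j)) (λ k → b k i)))

  open LinearAlgebraProperties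
  open SetoidReasoning setoid

  abstract

    pseudoinverse-exists : ∀ {m n} (A : Matrix m n) → ∃ (IsMoorePenroseInverse A)
    pseudoinverse-exists {m} {n} A with leastSquares n A | leastSquares m (A ᵀ)
    ... | X , AXA≋A , AX-sym | Z , AᵀZAᵀ≋Aᵀ , AᵀZ-sym = Y ⊡ A ⊡ X , record
      { AXA≋A        = λ i j → trans (⊡-congʳ A AM≋AX i j) (AXA≋A i j)
      ; XAX≋X        = λ i j → trans (⊡-congʳ M MA≋YA i j)
                         (trans (sym (⊡-assoc (Y ⊡ A) (Y ⊡ A) X i j))
                         (⊡-congʳ X YAYA≋YA i j))
      ; AX-symmetric = λ i j → trans (AM≋AX j i) (trans (AX-sym i j) (sym (AM≋AX i j)))
      ; XA-symmetric = λ i j → trans (MA≋YA j i) (trans (YA-sym i j) (sym (MA≋YA i j)))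
      }
      where
      Y M : Matrix n m
      Y = Z ᵀ
      M = Y ⊡ A ⊡ X
      YA≋ᵀ : Y ⊡ A ≋ (A ᵀ ⊡ Z) ᵀ
      YA≋ᵀ i j = sym (⊡-ᵀ (A ᵀ) Z i j)
      YA-sym : IsSymmetric (Y ⊡ A)
      YA-sym i j = trans (YA≋ᵀ j i) (trans (sym (AᵀZ-sym i j)) (sym (YA≋ᵀ i j)))
      AYA≋A : A ⊡ (Y ⊡ A) ≋ A
      AYA≋A i j = trans (⊡-congˡ A YA≋ᵀ i j)
                    (trans (sym (⊡-ᵀ (A ᵀ ⊡ Z) (A ᵀ) i j)) (AᵀZAᵀ≋Aᵀ j i))
      YAYA≋YA : Y ⊡ A ⊡ (Y ⊡ A) ≋ Y ⊡ A
      YAYA≋YA i j = trans (⊡-assoc Y A (Y ⊡ A) i j) (⊡-congˡ Y AYA≋A i j)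
      AM≋AX : A ⊡ M ≋ A ⊡ X
      AM≋AX i j = trans (sym (⊡-assoc A (Y ⊡ A) X i j)) (⊡-congʳ X AYA≋A i j)
      MA≋YA : M ⊡ A ≋ Y ⊡ A
      MA≋YA i j = trans (⊡-assoc (Y ⊡ A) X A i j) (trans (⊡-assoc Y A (X ⊡ A) i j)
                    (⊡-congˡ Y (λ k l → trans (sym (⊡-assoc A X A k l)) (AXA≋A k l)) i j))

    rank-exists : ∀ {m n} (A : Matrix m n) → ∃ (IsRank A)
    rank-exists {n = zero} A = 0 , record
      { basis             = λ ()
      ; basis-independent = λ _ _ ()
      ; basis⊆columnSpace = λ ()
      ; columns⊆span      = λ ()
      }
    rank-exists {m} {suc n} B with rank-exists (Extend.A B) | leastSquares n (Extend.A B)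
    ... | r , isRank | X , ls with all? (λ i → Residual.u (Extend.A B) X ls (Extend.v B) i ≟ 0#)
    ...   | yes u≈0 = r , record
      { basis             = basis
      ; basis-independent = basis-independent
      ; basis⊆columnSpace = λ k → weaken (basis⊆columnSpace k)
      ; columns⊆span      = λ
          { zero    → InSpan-trans columns⊆span
                        (z , λ i → trans (v≈u+Az i) (trans (+-congʳ (u≈0 i))
                             (trans (+-identityˡ _) (dot-comm _ z))))
          ; (suc j) → columns⊆span j
          }
      }
      where
      open Extend B
      open Residual A X ls v
      open IsRank isRank
      weaken : ∀ {x} → InSpan (A ᵀ) x → InSpan (B ᵀ) x
      weaken (y , x≈) = (λ { zero → 0# ; (suc j) → y j }) ,
        λ i → trans (x≈ i) (sym (trans (+-congʳ (zeroˡ _)) (+-identityˡ _)))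
    ...   | no ¬u≈0 = suc r , record
      { basis             = basis′
      ; basis-independent = independent
      ; basis⊆columnSpace = λ
          { zero    → (λ { zero → 1# ; (suc j) → 0# }) ,
                      λ i → sym (trans (+-cong (*-identityˡ _) (∑-zero n (λ j → zeroˡ (A i j)))) (+-identityʳ _))
          ; (suc k) → weaken (basis⊆columnSpace k)
          }
      ; columns⊆span      = λ
          { zero    → (λ { zero → 1# ; (suc j) → 0# }) ,
                      λ i → sym (trans (+-cong (*-identityˡ _) (∑-zero r (λ k → zeroˡ (basis k i)))) (+-identityʳ _))
          ; (suc j) → (λ { zero → 0# ; (suc k) → proj₁ (columns⊆span j) k }) ,
                      λ i → trans (proj₂ (columns⊆span j) i) (sym (trans (+-congʳ (zeroˡ _)) (+-identityˡ _)))
          }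
      }
      where
      open Extend B
      open Residual A X ls v
      open IsRank isRank
      weaken : ∀ {x} → InSpan (A ᵀ) x → InSpan (B ᵀ) x
      weaken (y , x≈) = (λ { zero → 0# ; (suc j) → y j }) ,
        λ i → trans (x≈ i) (sym (trans (+-congʳ (zeroˡ _)) (+-identityˡ _)))
      basis′ : Fin (suc r) → Vector Carrier m
      basis′ zero    = v
      basis′ (suc k) = basis k
      u∙basis≈0 : ∀ k → dot u (basis k) ≈ 0#
      u∙basis≈0 k with basis⊆columnSpace k
      ... | y , b≈ = trans (∑-cong m (λ i → *-congˡ (trans (b≈ i) (dot-comm y _)))) (u∙span≈0 y)
      independent : LinearlyIndependent basis′
      independent x Σ≈0 = λ { zero → x₀≈0 ; (suc k) → rest k }
        where
        x₀uu≈0 : x zero * dot u u ≈ 0#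
        x₀uu≈0 = sym (begin
          0#
            ≈⟨ sym (∑-zero m (λ i → trans (*-congˡ (Σ≈0 i)) (zeroʳ (u i)))) ⟩
          dot u (λ i → sum (λ k → x k * basis′ k i))
            ≈⟨ ∑-cong m (λ i → *-congˡ (∑-cong (suc r) (λ k → *-comm (x k) (basis′ k i)))) ⟩
          dot u (λ i → dot (λ k → basis′ k i) x)
            ≈⟨ ∑-assoc u (λ i k → basis′ k i) x ⟩
          dot u v * x zero + sum (λ k → dot u (basis k) * x (suc k))
            ≈⟨ +-cong (trans (*-congʳ u∙v≈u∙u) (*-comm _ _))
                      (∑-zero r (λ k → trans (*-congʳ (u∙basis≈0 k)) (zeroˡ _))) ⟩
          x zero * dot u u + 0#
            ≈⟨ +-identityʳ _ ⟩
          x zero * dot u u ∎)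
        x₀≈0 : x zero ≈ 0#
        x₀≈0 = x*y≈0⇒x≈0 (λ uu≈0 → ¬u≈0 (dot≈0 u uu≈0)) x₀uu≈0
        rest : ∀ k → x (suc k) ≈ 0#
        rest = basis-independent (λ k → x (suc k)) λ i →
          trans (sym (trans (+-congʳ (trans (*-congʳ x₀≈0) (zeroˡ _))) (+-identityˡ _))) (Σ≈0 i)

  -- rank and _† are determined by their specifications (the latter up to
  -- _≋_), so the constructions above are abstract.

  rank : ∀ {m n} → Matrix m n → ℕ
  rank A = proj₁ (rank-exists A)

  rank-isRank : ∀ {m n} (A : Matrix m n) → IsRank A (rank A)
  rank-isRank A = proj₂ (rank-exists A)

  infix 9 _†

  _† : ∀ {m n} → Matrix m n → Matrix n m
  A † = proj₁ (pseudoinverse-exists A)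

  †-isMoorePenroseInverse : ∀ {m n} (A : Matrix m n) → IsMoorePenroseInverse A (A †)
  †-isMoorePenroseInverse A = proj₂ (pseudoinverse-exists A)

IsConnectedGraph : {A : Set a} → Rel A ℓ → Set (a ⊔ ℓ)
IsConnectedGraph _~_ = ∀ x y → Star _~_ x y

InducedP₄ : {A : Set a} → Rel A ℓ → Set (a ⊔ ℓ)
InducedP₄ {A = A} _~_ = Σ[ p ∈ (Fin 4 → A) ] Injective _≡_ _≡_ p ×
  (∀ i j → (p i ~ p j) ⇔ (toℕ j ≡ suc (toℕ i) ⊎ toℕ i ≡ suc (toℕ j)))

IsCograph : {A : Set a} → Rel A ℓ → Set (a ⊔ ℓ)
IsCograph _~_ = ¬ InducedP₄ _~_

select : {P : Pred (Fin n) ℓ} → Decidable P → Subset n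
select P? = tabulate (λ i → does (P? i))

element : (p : Subset n) → Fin ∣ p ∣ → Fin n
element (inside  ∷ p) zero    = zero
element (inside  ∷ p) (suc i) = suc (element p i)
element (outside ∷ p) i       = suc (element p i)

-- All vertex sets are subsets of an ambient finite set Fin n, so that two
-- hypergraphs can share vertices and edges without having the same vertex
-- set.
record Hypergraph (n : ℕ) : Set where
  field
    V              : Subset n
    size           : ℕ
    edge           : Fin size → Subset n
    edge-injective : Injective _≡_ _≡_ edge
    edge⊆V         : ∀ e → edge e ⊆ V

module _ {n} (F : Hypergraph n) where

  open Hypergraph F

  IsUniform : ℕ → Set
  IsUniform s = ∀ e → ∣ edge e ∣ ≡ s

  IsLinear : Set
  IsLinear = ∀ e f → e ≢ f → ∣ edge e ∩ edge f ∣ ℕ.≤ 1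

  LineGraph : Rel (Fin size) _
  LineGraph e f = e ≢ f × Nonempty (edge e ∩ edge f)

  V⁺ : Subset n
  V⁺ = select (λ v → any? (λ e → v ∈? edge e))

  IsConnected : Set
  IsConnected = IsConnectedGraph LineGraph × V ⊆ V⁺

module _ {c ℓ₁ ℓ₂} (K : OrderedField c ℓ₁ ℓ₂) {n} (F : Hypergraph n) where

  open OrderedField K using (Carrier; 0#; 1#)
  open Hypergraph F

  incidence : Matrix K size ∣ V⁺ F ∣
  incidence e j = if does (element (V⁺ F) j ∈? edge e) then 1# else 0#

  R : ℕ → ℤ
  R s = + suc s ℤ.* + rank K incidence ℤ.- + s ℤ.* + size

  C : ℤ
  C = + ∣ V⁺ F ∣ ℤ.- + rank K incidence

  leverage : Fin size → Carrier
  leverage e = (_⊡_ K incidence (_† K incidence)) e e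

-- line c 0, …, line c (s ∸ 1) are the lines of the c-th parallel class.
-- Linearity is a consequence of line-disjoint and line-meet.
record Net (n s a : ℕ) : Set where
  field
    points        : Subset n
    points-size   : ∣ points ∣ ≡ s ℕ.* s
    line          : Fin a → Fin s → Subset n
    line⊆points   : ∀ c i → line c i ⊆ points
    line-size     : ∀ c i → ∣ line c i ∣ ≡ s
    line-disjoint : ∀ c i j → i ≢ j → Empty (line c i ∩ line c j)
    line-cover    : ∀ c {v} → v ∈ points → ∃[ i ] v ∈ line c i
    line-meet     : ∀ {c c′} → c ≢ c′ → ∀ i j → ∣ line c i ∩ line c′ j ∣ ≡ 1

AffinePlane : (n s : ℕ) → Set
AffinePlane n s = Net n s (suc s)

deficiency : (s a : ℕ) → ℤ
deficiency s a = + suc s ℤ.- + a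

module _ {n s a : ℕ} (Π : Net n s a) where

  open Net Π

  IsLine : Subset n → Set
  IsLine L = ∃[ c ] ∃[ i ] line c i ≡ L

  LineWithClassIn : Subset a → Pred (Subset n) _
  LineWithClassIn D L = ∃[ c ] (c ∈ D × ∃[ i ] line c i ≡ L)

  lineWithClassIn? : (D : Subset a) → Decidable (LineWithClassIn D)
  lineWithClassIn? D L =
    any? (λ c → c ∈? D ×-dec any? (λ i → Vec.≡-dec Bool._≟_ (line c i) L))

module _ {n s a : ℕ} (F : Hypergraph n) (Π : Net n s a) where

  open Hypergraph F
  open Net Π

  _⊆ᴸ_ : Set
  _⊆ᴸ_ = ∀ e → IsLine Π (edge e)

  ContainsClass : Fin a → Set
  ContainsClass c = ∀ i → ∃[ e ] edge e ≡ line c i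

  edgesWithClassIn : Subset a → Subset size
  edgesWithClassIn D = select (λ e → lineWithClassIn? Π D (edge e))

EmbedsIn : ∀ {n s a} → Net n s a → AffinePlane n s → Set
EmbedsIn N Π =
  Net.points N ≡ Net.points Π ×
  (∀ c → ∃[ c′ ] ((∀ i → ∃[ j ] Net.line Π c′ j ≡ Net.line N c i) ×
                  (∀ j → ∃[ i ] Net.line N c i ≡ Net.line Π c′ j)))

Comp : (s d : ℕ) → Set
Comp s d =
  (∀ {n a} (N : Net n s a) → deficiency s a ℤ.≤ + d → ∃[ Π ] EmbedsIn {n} N Π) ×
  (+ d ℤ.- 1ℤ) ℤ.^ 2 ℤ.< + s

{-# OPTIONS --safe #-}
module Submission where

open import Defs
open import Data.Nat.Base as ℕ using (ℕ; zero; suc; _∸_)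
open import Data.Integer.Base as ℤ using (+_; 1ℤ)
open import Data.Fin.Base using (Fin; zero; suc; punchIn)
import Data.Fin.Properties as Fin
open import Data.Fin.Subset using (Subset; inside; outside; Empty; Nonempty; ∣_∣; ∁; _∩_; _∈_; _⊆_)
open import Data.Fin.Subset.Properties
  using (_∈?_; nonempty?; Empty-unique; ∣⊥∣≡0; ∩-idem; x∈p∩q⁺; x∈∁p⇒x∉p; x∉p⇒x∈∁p; ⊆-antisym)
import Data.Integer.Properties as ℤ
import Data.Integer.Tactic.RingSolver as ℤ-Solver
import Data.Nat.Properties as ℕ
import Data.Nat.Tactic.RingSolver as ℕ-Solver
open import Data.Vec.Base using ([]; _∷_; here; there)
open import Data.Vec.Properties using (lookup⇒[]=; []=⇒lookup; lookup∘tabulate)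
open import Data.Product.Base using (_×_; _,_; proj₁; proj₂)
open import Data.Bool.Base using (if_then_else_)
open import Data.Vec.Functional using (Vector)
open import Relation.Binary.PropositionalEquality as ≡ using (_≡_)
open import Relation.Nullary using (¬_; Dec; yes; no; does; contradiction)
open import Relation.Nullary.Decidable using (_×-dec_; dec-true)
open import Relation.Unary using (Decidable)
import Algebra.Solver.Ring.NaturalCoefficients.Default as SemiringSolver
import Algebra.Properties.Ring as RingProperties
import Algebra.Properties.Semiring.Sum as SemiringSum
import Algebra.Properties.Semiring.Mult as SemiringMult
import Relation.Binary.Reasoning.Setoid as SetoidReasoning

-- The value of R_s, together with the number of edges counted class by class,
-- determines rank N, so the left null space of N has dimension b = s − h.  It
-- contains the differences of the indicator vectors of the 1 + b full classes
-- (every point lies on exactly one line of each), so it is spanned by them.  The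
-- projector Q onto this span is explicit, and P_ee = 1 − Q_ee.  That P + Q = 1
-- on the diagonal is extracted from traces: P + Q is a projector of full trace.

-- Sums, traces and orthogonal projectors over an ordered field.

module FieldProperties {c ℓ₁ ℓ₂} (K : OrderedField c ℓ₁ ℓ₂) where

  open OrderedField K
  open RingProperties ring
  open LinearAlgebraProperties K
  open SemiringSum semiring using (sum; sum-remove; sum-replicate; ∑-comm)
  open SemiringMult semiring using (×-homo-+; ×1-homo-*)
  open SetoidReasoning setoid

  infixl 7 _∙_
  _∙_ : ∀ {m n p} → Matrix K m n → Matrix K n p → Matrix K m p
  _∙_ = _⊡_ K

  fromℕ-homo-+ : ∀ m n → fromℕ (m ℕ.+ n) ≈ fromℕ m + fromℕ n
  fromℕ-homo-+ = ×-homo-+ 1#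

  fromℕ-homo-* : ∀ m n → fromℕ (m ℕ.* n) ≈ fromℕ m * fromℕ n
  fromℕ-homo-* = ×1-homo-*

  0≤1 : 0# ≤ 1#
  0≤1 = ≤-respʳ-≈ (*-identityʳ 1#) (square-nonNeg 1#)

  fromℕ-nonNeg : ∀ n → 0# ≤ fromℕ n
  fromℕ-nonNeg zero    = ≤-refl
  fromℕ-nonNeg (suc n) = +-nonNeg 0≤1 (fromℕ-nonNeg n)

  -- The order forces characteristic zero: if the nonnegative terms `1#` and `fromℕ n` added up to
  -- zero, `1#` itself would vanish.
  fromℕ-suc≉0 : ∀ n → ¬ (fromℕ (suc n) ≈ 0#)
  fromℕ-suc≉0 n 1+n≈0 = 0≉1 (sym (nonNeg-+≈0 0≤1 (fromℕ-nonNeg n) 1+n≈0))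

  -- Lets edges be counted by indicator sums in the field and the result be read back in `ℕ`.
  fromℕ-injective : ∀ m n → fromℕ m ≈ fromℕ n → m ≡ n
  fromℕ-injective zero    zero    _  = ≡.refl
  fromℕ-injective zero    (suc n) eq = contradiction (sym eq) (fromℕ-suc≉0 n)
  fromℕ-injective (suc m) zero    eq = contradiction eq (fromℕ-suc≉0 m)
  fromℕ-injective (suc m) (suc n) eq = ≡.cong suc (fromℕ-injective m n (+-cancelˡ 1# _ _ eq))

  -- Has the same shape as the entries of `incidence`, which are thus definitionally indicators
  -- `[ v ∈? edge e ]`.
  [_] : ∀ {p} {P : Set p} → Dec P → Carrier
  [ P? ] = if does P? then 1# else 0#

  []-yes : ∀ {p} {P : Set p} (P? : Dec P) → P → [ P? ] ≈ 1#
  []-yes (yes _) _ = refl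
  []-yes (no ¬p) p = contradiction p ¬p

  []-no : ∀ {p} {P : Set p} (P? : Dec P) → ¬ P → [ P? ] ≈ 0#
  []-no (yes p) ¬p = contradiction p ¬p
  []-no (no _)  _  = refl

  []-cong : ∀ {p q} {P : Set p} {Q : Set q} (P? : Dec P) (Q? : Dec Q) →
            (P → Q) → (Q → P) → [ P? ] ≈ [ Q? ]
  []-cong P? (yes q) f g = []-yes P? (g q)
  []-cong P? (no ¬q) f g = []-no P? (λ p → ¬q (f p))

  ∑-1 : ∀ n → sum {n} (λ _ → 1#) ≈ fromℕ n
  ∑-1 n = sum-replicate n

  ∑-∸ : ∀ n (x y : Vector Carrier n) → sum (λ i → x i - y i) ≈ sum x - sum y
  ∑-∸ n x y = trans (∑-+ n x (λ i → - y i)) (+-congˡ (∑-neg y))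

  ∑-single : ∀ n {p} {P : Fin n → Set p} (P? : Decidable P) (f : Vector Carrier n) {i} →
             P i → (∀ {j} → P j → j ≡ i) → sum (λ j → [ P? j ] * f j) ≈ f i
  ∑-single (suc n) P? f {i} Pi unique = begin
    sum (λ j → [ P? j ] * f j)
      ≈⟨ sum-remove {i = i} (λ j → [ P? j ] * f j) ⟩
    [ P? i ] * f i + sum (λ j → [ P? (punchIn i j) ] * f (punchIn i j))
      ≈⟨ +-cong (trans (*-congʳ ([]-yes (P? i) Pi)) (*-identityˡ _))
                (∑-zero n (λ j → trans (*-congʳ ([]-no (P? _)
                  (λ p → Fin.punchInᵢ≢i i j (unique p)))) (zeroˡ _))) ⟩
    f i + 0#
      ≈⟨ +-identityʳ _ ⟩
    f i ∎

  ∑-nonNeg : ∀ n (x : Vector Carrier n) → (∀ i → 0# ≤ x i) → 0# ≤ sum x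
  ∑-nonNeg zero    x 0≤x = ≤-refl
  ∑-nonNeg (suc n) x 0≤x = +-nonNeg (0≤x zero) (∑-nonNeg n _ (λ i → 0≤x (suc i)))

  ∑-nonNeg≈0 : ∀ n (x : Vector Carrier n) → (∀ i → 0# ≤ x i) → sum x ≈ 0# → ∀ i → x i ≈ 0#
  ∑-nonNeg≈0 (suc n) x 0≤x Σ≈0 zero    =
    nonNeg-+≈0 (0≤x zero) (∑-nonNeg n _ (λ i → 0≤x (suc i))) Σ≈0
  ∑-nonNeg≈0 (suc n) x 0≤x Σ≈0 (suc i) = ∑-nonNeg≈0 n _ (λ i → 0≤x (suc i))
    (nonNeg-+≈0 (∑-nonNeg n _ (λ i → 0≤x (suc i))) (0≤x zero) (trans (+-comm _ _) Σ≈0)) i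

  [x-y]+y≈x : ∀ x y → (x - y) + y ≈ x
  [x-y]+y≈x x y = trans (+-assoc x (- y) y) (trans (+-congˡ (-‿inverseˡ y)) (+-identityʳ x))

  x+y≈z⇒x≈z-y : ∀ {x y z} → x + y ≈ z → x ≈ z - y
  x+y≈z⇒x≈z-y {x} {y} {z} eq = +-cancelʳ y x (z - y) (trans eq (sym ([x-y]+y≈x z y)))

  fromℕ-∸ : ∀ m n {k} → m ℕ.+ n ≡ k → fromℕ k - fromℕ m ≈ fromℕ n
  fromℕ-∸ m n ≡.refl = sym (x+y≈z⇒x≈z-y (trans (+-comm _ _) (sym (fromℕ-homo-+ m n))))

  trace : ∀ {n} → Matrix K n n → Carrier
  trace A = sum (λ i → A i i)

  𝟙 : ∀ n → Matrix K n n
  𝟙 n i j = [ j Fin.≟ i ]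

  trace-𝟙 : ∀ n → trace (𝟙 n) ≈ fromℕ n
  trace-𝟙 n = trans (∑-cong n (λ i → []-yes (i Fin.≟ i) ≡.refl)) (∑-1 n)

  dot-𝟙 : ∀ {n} i (x : Vector Carrier n) → dot (𝟙 n i) x ≈ x i
  dot-𝟙 {n} i x = ∑-single n (λ j → j Fin.≟ i) x ≡.refl (λ eq → eq)

  trace-⊡-comm : ∀ {m n} (A : Matrix K m n) (B : Matrix K n m) →
                 trace (A ∙ B) ≈ trace (B ∙ A)
  trace-⊡-comm {m} {n} A B = trans (∑-comm {m} {n} (λ i j → A i j * B j i))
    (∑-cong n (λ j → ∑-cong m (λ i → *-comm (A i j) (B j i))))

  -- Factoring `A` through a basis of its column space gives `A ∙ X = B ∙ W` with `W ∙ B` the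
  -- identity of size `r`; cyclicity of the trace reduces the claim to that identity.
  trace-⊡-generalizedInverse : ∀ {m n r} (A : Matrix K m n) (X : Matrix K n m) →
    IsRank K A r → _≋_ K (A ∙ X ∙ A) A → trace (A ∙ X) ≈ fromℕ r
  trace-⊡-generalizedInverse {m} {n} {r} A X isRank AXA≋A = begin
    trace (A ∙ X)   ≈⟨ ∑-cong m (λ i → AX≋BW i i) ⟩
    trace (B ∙ W)   ≈⟨ trace-⊡-comm B W ⟩
    trace (W ∙ B)   ≈⟨ ∑-cong r (λ k → WB≋𝟙 k k) ⟩
    trace (𝟙 r)     ≈⟨ trace-𝟙 r ⟩
    fromℕ r         ∎
    where
    open IsRank isRank
    B : Matrix K m r
    B i k = basis k i
    Y : Matrix K r n
    Y k j = proj₁ (columns⊆span j) k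
    Z : Matrix K n r
    Z j k = proj₁ (basis⊆columnSpace k) j
    W : Matrix K r m
    W = Y ∙ X
    A≋BY : ∀ i j → A i j ≈ (B ∙ Y) i j
    A≋BY i j = trans (proj₂ (columns⊆span j) i) (∑-cong r (λ k → *-comm (Y k j) (B i k)))
    B≋AZ : ∀ i k → B i k ≈ (A ∙ Z) i k
    B≋AZ i k = trans (proj₂ (basis⊆columnSpace k) i) (∑-cong n (λ j → *-comm (Z j k) (A i j)))
    AX≋BW : ∀ i j → (A ∙ X) i j ≈ (B ∙ W) i j
    AX≋BW i j = trans (⊡-congʳ X A≋BY i j) (⊡-assoc B Y X i j)
    -- The columns of `B` lie in the column space of `A`, which `A ∙ X` fixes pointwise.
    BWB≋B : ∀ i k → (B ∙ (W ∙ B)) i k ≈ B i k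
    BWB≋B i k = begin
      (B ∙ (W ∙ B)) i k       ≈⟨ ⊡-assoc B W B i k ⟨
      (B ∙ W ∙ B) i k         ≈⟨ ⊡-congʳ B AX≋BW i k ⟨
      (A ∙ X ∙ B) i k         ≈⟨ ⊡-congˡ (A ∙ X) B≋AZ i k ⟩
      (A ∙ X ∙ (A ∙ Z)) i k   ≈⟨ ⊡-assoc (A ∙ X) A Z i k ⟨
      (A ∙ X ∙ A ∙ Z) i k     ≈⟨ ⊡-congʳ Z AXA≋A i k ⟩
      (A ∙ Z) i k             ≈⟨ B≋AZ i k ⟨
      B i k                   ∎
    -- Both `W ∙ B` and `𝟙 r` yield `B` when multiplied by `B` on the left, so each column of their
    -- difference gives a vanishing combination of basis vectors.
    WB≋𝟙 : ∀ k l → (W ∙ B) k l ≈ 𝟙 r k l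
    WB≋𝟙 k l = +-cancelʳ (- 𝟙 r k l) _ _ (trans
      (basis-independent (λ k → (W ∙ B) k l - 𝟙 r k l) combination≈0 k)
      (sym (-‿inverseʳ _)))
      where
      combination≈0 : ∀ i → sum (λ k → ((W ∙ B) k l - 𝟙 r k l) * B i k) ≈ 0#
      combination≈0 i = begin
        sum (λ k → ((W ∙ B) k l - 𝟙 r k l) * B i k)
          ≈⟨ ∑-cong r (λ k → trans (*-comm _ _) (x*[y-z] (B i k) _ _)) ⟩
        sum (λ k → B i k * (W ∙ B) k l - B i k * 𝟙 r k l)
          ≈⟨ ∑-∸ r _ _ ⟩
        (B ∙ (W ∙ B)) i l - sum (λ k → B i k * 𝟙 r k l)
          ≈⟨ +-cong (BWB≋B i l) (-‿cong (begin
               sum (λ k → B i k * 𝟙 r k l)  ≈⟨ ∑-cong r (λ k → trans (*-comm _ _) (*-congʳ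
                                                ([]-cong (l Fin.≟ k) (k Fin.≟ l) ≡.sym ≡.sym))) ⟩
               dot (𝟙 r l) (B i)            ≈⟨ dot-𝟙 l (B i) ⟩
               B i l                        ∎)) ⟩
        B i l - B i l
          ≈⟨ -‿inverseʳ _ ⟩
        0# ∎
        where
        x*[y-z] : ∀ x y z → x * (y - z) ≈ x * y - x * z
        x*[y-z] x y z = trans (distribˡ x y (- z)) (+-congˡ (sym (-‿distribʳ-* x z)))

  -- The complementary projector M = 𝟙 − T has trace 0, and its diagonal
  -- entries are the squared norms of its rows.
  fullTrace⇒diagonal≈1 : ∀ {n} (T : Matrix K n n) → IsSymmetric K T →
    _≋_ K (T ∙ T) T → trace T ≈ fromℕ n → ∀ i → T i i ≈ 1#
  fullTrace⇒diagonal≈1 {n} T T-sym TT≋T trT≈n i = begin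
    T i i            ≈⟨ +-identityˡ _ ⟨
    0# + T i i       ≈⟨ +-congʳ (trans (MM≈M i) (MM≈0 i)) ⟨
    M i i + T i i    ≈⟨ M+T i i ⟩
    𝟙 n i i          ≈⟨ []-yes (i Fin.≟ i) ≡.refl ⟩
    1#               ∎
    where
    M : Matrix K n n
    M i j = 𝟙 n i j - T i j
    M+T : ∀ i j → M i j + T i j ≈ 𝟙 n i j
    M+T i j = [x-y]+y≈x _ _
    dot-M+T : ∀ i x → dot (M i) x + dot (T i) x ≈ x i
    dot-M+T i x = begin
      dot (M i) x + dot (T i) x               ≈⟨ ∑-+ n (λ k → M i k * x k) (λ k → T i k * x k) ⟨
      sum (λ k → M i k * x k + T i k * x k)   ≈⟨ ∑-cong n (λ k → trans (sym (distribʳ _ _ _)) (*-congʳ (M+T i k))) ⟩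
      dot (𝟙 n i) x                           ≈⟨ dot-𝟙 i x ⟩
      x i                                     ∎
    TTᵀ : ∀ i → dot (T i) (T i) ≈ T i i
    TTᵀ i = trans (∑-cong n (λ k → *-congˡ (T-sym k i))) (TT≋T i i)
    -- Pairing row `i` of `M + T = 𝟙` with `T i` gives `T i i`, and the `T` part already accounts
    -- for all of it.
    M∙T≈0 : ∀ i → dot (M i) (T i) ≈ 0#
    M∙T≈0 i = +-identityˡ-unique _ (T i i) (trans (+-congˡ (sym (TTᵀ i))) (dot-M+T i (T i)))
    MM≈M : ∀ i → M i i ≈ dot (M i) (M i)
    MM≈M i = begin
      M i i                            ≈⟨ dot-M+T i (M i) ⟨
      dot (M i) (M i) + dot (T i) (M i) ≈⟨ +-congˡ (trans (dot-comm (T i) (M i)) (M∙T≈0 i)) ⟩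
      dot (M i) (M i) + 0#             ≈⟨ +-identityʳ _ ⟩
      dot (M i) (M i)                  ∎
    trM≈0 : trace M ≈ 0#
    trM≈0 = begin
      trace M               ≈⟨ ∑-∸ n _ _ ⟩
      trace (𝟙 n) - trace T ≈⟨ +-cong (trace-𝟙 n) (-‿cong trT≈n) ⟩
      fromℕ n - fromℕ n     ≈⟨ -‿inverseʳ _ ⟩
      0#                    ∎
    MM≈0 : ∀ i → dot (M i) (M i) ≈ 0#
    MM≈0 = ∑-nonNeg≈0 n _ (λ i → dot-nonNeg (M i))
             (trans (sym (∑-cong n MM≈M)) trM≈0)

  -- `Q` kills the column space of `A`, hence is orthogonal to `P = A ∙ X`. So `P + Q` is a
  -- symmetric idempotent, and its full trace fixes the diagonal.
  complementaryProjectors : ∀ {m n} (A : Matrix K m n) (X : Matrix K n m) (Q : Matrix K m m) →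
    IsMoorePenroseInverse K A X → IsSymmetric K Q → _≋_ K (Q ∙ Q) Q →
    (∀ i j → (Q ∙ A) i j ≈ 0#) → trace (A ∙ X) + trace Q ≈ fromℕ m →
    ∀ i → (A ∙ X) i i + Q i i ≈ 1#
  complementaryProjectors {m} {n} A X Q mp Q-sym QQ≋Q QA≈0 trace≈m =
    fullTrace⇒diagonal≈1 T (λ i j → +-cong (AX-symmetric i j) (Q-sym i j)) TT≋T
      (trans (∑-+ m _ _) trace≈m)
    where
    open IsMoorePenroseInverse mp
    P T : Matrix K m m
    P = A ∙ X
    T i j = P i j + Q i j
    QP≈0 : ∀ i j → (Q ∙ P) i j ≈ 0#
    QP≈0 i j = begin
      (Q ∙ (A ∙ X)) i j   ≈⟨ ⊡-assoc Q A X i j ⟨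
      (Q ∙ A ∙ X) i j     ≈⟨ ∑-zero n (λ k → trans (*-congʳ (QA≈0 i k)) (zeroˡ _)) ⟩
      0#                  ∎
    -- The transpose of `Q ∙ P = 0`, both factors being symmetric.
    PQ≈0 : ∀ i j → (P ∙ Q) i j ≈ 0#
    PQ≈0 i j = trans (∑-cong m (λ k → trans (*-cong (AX-symmetric k i) (Q-sym j k)) (*-comm _ _))) (QP≈0 j i)
    PP≋P : ∀ i j → (P ∙ P) i j ≈ P i j
    PP≋P i j = trans (sym (⊡-assoc P A X i j)) (⊡-congʳ X AXA≋A i j)
    TT≋T : ∀ i j → (T ∙ T) i j ≈ T i j
    TT≋T i j = begin
      (T ∙ T) i j
        ≈⟨ ∑-cong m (λ k → trans (distribʳ _ _ _) (+-cong (distribˡ _ _ _) (distribˡ _ _ _))) ⟩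
      sum (λ k → (P i k * P k j + P i k * Q k j) + (Q i k * P k j + Q i k * Q k j))
        ≈⟨ trans (∑-+ m _ _) (+-cong (∑-+ m _ _) (∑-+ m _ _)) ⟩
      ((P ∙ P) i j + (P ∙ Q) i j) + ((Q ∙ P) i j + (Q ∙ Q) i j)
        ≈⟨ +-cong (+-cong (PP≋P i j) (PQ≈0 i j)) (+-cong (QP≈0 i j) (QQ≋Q i j)) ⟩
      (P i j + 0#) + (0# + Q i j)
        ≈⟨ +-cong (+-identityʳ _) (+-identityˡ _) ⟩
      T i j ∎

  []-idem : ∀ {p} {P : Set p} (P? : Dec P) → [ P? ] * [ P? ] ≈ [ P? ]
  []-idem (yes _) = *-identityʳ 1#
  []-idem (no _)  = zeroʳ 0#

  []-×-dec : ∀ {p q} {P : Set p} {Q : Set q} (P? : Dec P) (Q? : Dec Q) →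
             [ P? ×-dec Q? ] ≈ [ P? ] * [ Q? ]
  []-×-dec (yes _) Q? = sym (*-identityˡ _)
  []-×-dec (no _)  Q? = sym (zeroˡ _)

  []-×-¬ : ∀ {p q} {P : Set p} {Q : Set q} (P? : Dec P) (Q? : Dec Q) →
           (¬ P → Q) → (Q → ¬ P) → [ P? ] + [ Q? ] ≈ 1#
  []-×-¬ (yes p) Q? _ g = trans (+-congˡ ([]-no Q? (λ q → g q p))) (+-identityʳ 1#)
  []-×-¬ (no ¬p) Q? f _ = trans (+-identityˡ _) ([]-yes Q? (f ¬p))

  ∑-∈? : ∀ {n} (p : Subset n) → sum (λ i → [ i ∈? p ]) ≈ fromℕ ∣ p ∣
  ∑-∈? []            = refl
  ∑-∈? (inside  ∷ p) = +-congˡ (∑-∈? p)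
  ∑-∈? (outside ∷ p) = trans (+-identityˡ _) (∑-∈? p)

  ∑-select : ∀ {n p} {P : Fin n → Set p} (P? : Decidable P) →
             sum (λ i → [ P? i ]) ≈ fromℕ ∣ select P? ∣
  ∑-select {zero}  P? = refl
  ∑-select {suc n} P? with P? zero
  ... | yes _ = +-congˡ (∑-select (λ i → P? (suc i)))
  ... | no  _ = trans (+-identityˡ _) (∑-select (λ i → P? (suc i)))

-- Membership in finite subsets.

∈-select⁺ : ∀ {n p} {P : Fin n → Set p} (P? : Decidable P) {i} → P i → i ∈ select P?
∈-select⁺ P? {i} Pi = lookup⇒[]= i _ (≡.trans (lookup∘tabulate _ i) (dec-true (P? i) Pi))

∈-select⁻ : ∀ {n p} {P : Fin n → Set p} (P? : Decidable P) {i} → i ∈ select P? → P i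
∈-select⁻ P? {i} i∈ with P? i | ≡.trans (≡.sym (lookup∘tabulate (λ i → does (P? i)) i)) ([]=⇒lookup i∈)
... | yes Pi | _  = Pi
... | no _   | ()

element∈ : ∀ {n} (p : Subset n) i → element p i ∈ p
element∈ (inside  ∷ p) zero    = here
element∈ (inside  ∷ p) (suc i) = there (element∈ p i)
element∈ (outside ∷ p) i       = there (element∈ p i)

-- Lines of a net.

module NetProperties {n s m} (Π : Net n s m) (1<s : 1 ℕ.< s) where

  open Net Π

  -- A line meets itself in `s > 1` points, whereas lines of different classes share one point and
  -- distinct lines of one class share none.
  line-injective : ∀ {c c′ i j} → line c i ≡ line c′ j → c ≡ c′ × i ≡ j
  line-injective {c} {c′} {i} {j} eq = classes , positions
    where
    ∣∩∣≡s : ∣ line c i ∩ line c′ j ∣ ≡ s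
    ∣∩∣≡s = ≡.trans (≡.cong (λ L → ∣ line c i ∩ L ∣) (≡.sym eq))
              (≡.trans (≡.cong ∣_∣ (∩-idem (line c i))) (line-size c i))
    classes : c ≡ c′
    classes with c Fin.≟ c′
    ... | yes c≡c′ = c≡c′
    ... | no  c≢c′ = contradiction (≡.trans (≡.sym ∣∩∣≡s) (line-meet c≢c′ i j)) (ℕ.>⇒≢ 1<s)
    positions : i ≡ j
    positions with i Fin.≟ j
    ... | yes i≡j = i≡j
    ... | no  i≢j = contradiction (≡.trans (≡.sym ∣∩∣≡s) ∣∩∣≡0) (ℕ.>⇒≢ (ℕ.<-trans ℕ.0<1+n 1<s))
      where
      ∣∩∣≡0 : ∣ line c i ∩ line c′ j ∣ ≡ 0
      ∣∩∣≡0 = ≡.trans (≡.cong ∣_∣ (Empty-unique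
        (≡.subst (λ c → Empty (line c i ∩ line c′ j)) (≡.sym classes) (line-disjoint c′ i j i≢j))))
        (∣⊥∣≡0 n)

  line-unique : ∀ {c v i j} → v ∈ line c i → v ∈ line c j → i ≡ j
  line-unique {c} {v} {i} {j} v∈i v∈j with i Fin.≟ j
  ... | yes i≡j = i≡j
  ... | no  i≢j = contradiction (v , x∈p∩q⁺ (v∈i , v∈j)) (line-disjoint c i j i≢j)

-- Summation over the edges in full parallel classes.

module FullClasses {c ℓ₁ ℓ₂} (K : OrderedField c ℓ₁ ℓ₂) {n s m} (F : Hypergraph n) (Π : Net n s m)
  (1<s : 1 ℕ.< s) (F⊆Π : F ⊆ᴸ Π) (full : Subset m) (contains : ∀ c → c ∈ full → ContainsClass F Π c) where

  open OrderedField K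
  open RingProperties ring
  open LinearAlgebraProperties K
  open FieldProperties K
  open SemiringSum semiring using (sum; ∑-comm)
  open SemiringSolver commutativeSemiring using (solve; con; _:+_; _:*_; _:=_)
  open SetoidReasoning setoid
  open Hypergraph F
  open Net Π
  open NetProperties Π 1<s

  class : Fin size → Fin m
  class e = proj₁ (F⊆Π e)

  position : Fin size → Fin s
  position e = proj₁ (proj₂ (F⊆Π e))

  line≡edge : ∀ e → line (class e) (position e) ≡ edge e
  line≡edge e = proj₂ (proj₂ (F⊆Π e))

  -- `class` and `position` are read off the witness `F⊆Π`; injectivity of `line` makes every other
  -- witness agree with it.
  class-unique : ∀ {e c i} → line c i ≡ edge e → c ≡ class e × i ≡ position e
  class-unique {e} eq = line-injective (≡.trans eq (≡.sym (line≡edge e)))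

  -- Restriction to full classes is kept as a 0-1 weight, so that all sums run over a whole `Fin`
  -- and can be interchanged.
  σ : Fin m → Carrier
  σ c = [ c ∈? full ]

  σ-∉ : ∀ {c} → ¬ (c ∈ full) → σ c ≈ 0#
  σ-∉ = []-no (_ ∈? full)

  -- Inserting the indicator that the edge is `line c i` gives a triple sum. After interchange, each
  -- line of a full class is hit by exactly one edge, and the other lines have weight zero. A
  -- constant `φ` counts edges; incidence with a point as `φ` evaluates products with `incidence`.
  ∑-fullClasses : ∀ (g : Fin m → Carrier) (φ : Subset n → Carrier) t →
    (∀ c → sum (λ i → φ (line c i)) ≈ t) →
    sum (λ e → (σ (class e) * g (class e)) * φ (edge e)) ≈ sum (λ c → σ c * g c) * t
  ∑-fullClasses g φ t ∑φ≈t = begin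
    sum (λ e → (σ (class e) * g (class e)) * φ (edge e))
      ≈⟨ ∑-cong size split ⟩
    sum (λ e → sum (λ c → sum (λ i → [ at? c i e ] * f c i)))
      ≈⟨ ∑-comm (λ e c → sum (λ i → [ at? c i e ] * f c i)) ⟩
    sum (λ c → sum (λ e → sum (λ i → [ at? c i e ] * f c i)))
      ≈⟨ ∑-cong m (λ c → ∑-comm (λ e i → [ at? c i e ] * f c i)) ⟩
    sum (λ c → sum (λ i → sum (λ e → [ at? c i e ] * f c i)))
      ≈⟨ ∑-cong m (λ c → ∑-cong s (collect c)) ⟩
    sum (λ c → sum (λ i → f c i))
      ≈⟨ ∑-cong m (λ c → trans (sym (∑-*ˡ s (σ c * g c) (λ i → φ (line c i)))) (*-congˡ (∑φ≈t c))) ⟩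
    sum (λ c → σ c * g c * t)
      ≈⟨ ∑-*ʳ m t (λ c → σ c * g c) ⟨
    sum (λ c → σ c * g c) * t ∎
    where
    f : Fin m → Fin s → Carrier
    f c i = (σ c * g c) * φ (line c i)
    at? : ∀ c i → Decidable (λ e → c ≡ class e × i ≡ position e)
    at? c i e = c Fin.≟ class e ×-dec i Fin.≟ position e
    split : ∀ e → (σ (class e) * g (class e)) * φ (edge e) ≈ sum (λ c → sum (λ i → [ at? c i e ] * f c i))
    split e = sym (begin
      sum (λ c → sum (λ i → [ at? c i e ] * f c i))
        ≈⟨ ∑-cong m (λ c → ∑-cong s (λ i → trans
             (*-congʳ ([]-×-dec (c Fin.≟ class e) (i Fin.≟ position e))) (*-assoc _ _ _))) ⟩
      sum (λ c → sum (λ i → [ c Fin.≟ class e ] * ([ i Fin.≟ position e ] * f c i)))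
        ≈⟨ ∑-cong m (λ c → trans
             (sym (∑-*ˡ s [ c Fin.≟ class e ] (λ i → [ i Fin.≟ position e ] * f c i)))
             (*-congˡ (∑-single s (Fin._≟ position e) (f c) ≡.refl (λ eq → eq)))) ⟩
      sum (λ c → [ c Fin.≟ class e ] * f c (position e))
        ≈⟨ ∑-single m (Fin._≟ class e) (λ c → f c (position e)) ≡.refl (λ eq → eq) ⟩
      f (class e) (position e)
        ≡⟨ ≡.cong (λ L → (σ (class e) * g (class e)) * φ L) (line≡edge e) ⟩
      (σ (class e) * g (class e)) * φ (edge e) ∎)
    collect : ∀ c i → sum (λ e → [ at? c i e ] * f c i) ≈ f c i
    collect c i with c ∈? full
    -- A line outside the full classes may or may not be an edge; its weight is zero either way.
    ... | no  _      = trans (∑-zero size (λ e → trans (*-congˡ f≈0) (zeroʳ _))) (sym f≈0)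
      where
      f≈0 : 0# * g c * φ (line c i) ≈ 0#
      f≈0 = trans (*-congʳ (zeroˡ _)) (zeroˡ _)
    ... | yes c∈full with contains c c∈full i
    -- The match on `c ∈? full` has reduced `σ c` to `1#`, hence the `1#` in the summand. Uniqueness
    -- of the edge comes from `edge-injective`.
    ...   | e , edge≡line = ∑-single size (at? c i) (λ _ → 1# * g c * φ (line c i)) {e}
              (class-unique (≡.sym edge≡line))
              (λ { {e′} (≡.refl , ≡.refl) →
                   edge-injective (≡.trans (≡.sym (line≡edge e′)) (≡.sym edge≡line)) })

  1+x≈y⇒x≈y-1 : ∀ {x y} → 1# + x ≈ y → y - 1# ≈ x
  1+x≈y⇒x≈y-1 eq = sym (x+y≈z⇒x≈z-y (trans (+-comm _ _) eq))

  lineWithClassIn⇒class∈ : ∀ {D e} → LineWithClassIn Π D (edge e) → class e ∈ D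
  lineWithClassIn⇒class∈ (c , c∈D , i , eq) = ≡.subst (_∈ _) (proj₁ (class-unique eq)) c∈D

  ∑-fullEdges : sum (λ e → σ (class e)) ≈ fromℕ ∣ full ∣ * fromℕ s
  ∑-fullEdges = begin
    sum (λ e → σ (class e))             ≈⟨ ∑-cong size (λ e → trans (*-identityʳ _) (*-identityʳ _)) ⟨
    sum (λ e → σ (class e) * 1# * 1#)   ≈⟨ ∑-fullClasses (λ _ → 1#) (λ _ → 1#) (fromℕ s) (λ _ → ∑-1 s) ⟩
    sum (λ c → σ c * 1#) * fromℕ s      ≈⟨ *-congʳ (trans (∑-cong m (λ c → *-identityʳ _)) (∑-∈? full)) ⟩
    fromℕ ∣ full ∣ * fromℕ s            ∎

  V⁺⊆points : V⁺ F ⊆ points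
  V⁺⊆points v∈V⁺ with ∈-select⁻ (λ v → Fin.any? (λ e → v ∈? edge e)) v∈V⁺
  ... | e , v∈e = line⊆points (class e) (position e) (≡.subst (_ ∈_) (≡.sym (line≡edge e)) v∈e)

  -- A single full class already covers every point.
  points⊆V⁺ : ∀ {c} → c ∈ full → points ⊆ V⁺ F
  points⊆V⁺ {c} c∈full v∈points with line-cover c v∈points
  ... | i , v∈i with contains c c∈full i
  ...   | e , edge≡line = ∈-select⁺ (λ v → Fin.any? (λ e → v ∈? edge e)) (e , ≡.subst (_ ∈_) (≡.sym edge≡line) v∈i)

  -- The constant 1 on edges splits into the indicators of a full class and of a class in the
  -- complement; each full class accounts for `s` edges.
  size-count : size ≡ ∣ full ∣ ℕ.* s ℕ.+ ∣ edgesWithClassIn F Π (∁ full) ∣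
  size-count = fromℕ-injective _ _ (begin
    fromℕ size
      ≈⟨ ∑-1 size ⟨
    sum {size} (λ _ → 1#)
      ≈⟨ ∑-cong size (λ e → []-×-¬ (class e ∈? full) (partial? e)
           (λ e∉full → class e , x∉p⇒x∈∁p e∉full , position e , line≡edge e)
           (λ e∈∁full → x∈∁p⇒x∉p (lineWithClassIn⇒class∈ e∈∁full))) ⟨
    sum (λ e → σ (class e) + [ partial? e ])
      ≈⟨ ∑-+ size (λ e → σ (class e)) (λ e → [ partial? e ]) ⟩
    sum (λ e → σ (class e)) + sum (λ e → [ partial? e ])
      ≈⟨ +-cong (trans ∑-fullEdges (sym (fromℕ-homo-* ∣ full ∣ s))) (∑-select partial?) ⟩
    fromℕ (∣ full ∣ ℕ.* s) + fromℕ ∣ edgesWithClassIn F Π (∁ full) ∣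
      ≈⟨ fromℕ-homo-+ (∣ full ∣ ℕ.* s) _ ⟨
    fromℕ (∣ full ∣ ℕ.* s ℕ.+ ∣ edgesWithClassIn F Π (∁ full) ∣) ∎)
    where
    partial? : Decidable (λ e → LineWithClassIn Π (∁ full) (edge e))
    partial? e = lineWithClassIn? Π (∁ full) (edge e)

  -- With w_c the indicator vector of the class c and w the sum of w_c over
  -- the 1 + b full classes, Q = Σ w_c w_cᵀ / s − w wᵀ / (s (1 + b)).
  module NullProjector (b : ℕ) (∣full∣≡1+b : ∣ full ∣ ≡ suc b) where

    a κ : Carrier
    a = fromℕ (suc b)
    κ = (fromℕ s * a) ⁻¹

    ∑σ≈a : sum σ ≈ a
    ∑σ≈a = trans (∑-∈? full) (reflexive (≡.cong fromℕ ∣full∣≡1+b))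

    s*a*κ≈1 : fromℕ s * a * κ ≈ 1#
    s*a*κ≈1 = ⁻¹-inverse (s*a≉0 1<s)
      where
      -- Quantifying over `s` afresh allows a match that exposes `fromℕ (suc s)`.
      s*a≉0 : ∀ {s} → 1 ℕ.< s → ¬ (fromℕ s * a ≈ 0#)
      s*a≉0 {suc s} _ eq = fromℕ-suc≉0 s (x*y≈0⇒x≈0 (fromℕ-suc≉0 b) eq)

    -- On the full classes this is `aI - J`, with `J` the all-ones matrix of order `1 + b`. Its row
    -- sums vanish and its square is `a` times itself, so there `B / a` projects onto the complement
    -- of the all-ones vector.
    B : Matrix K m m
    B x y = a * [ y Fin.≟ x ] - 1#

    B-sym : IsSymmetric K B
    B-sym x y = +-congʳ (*-congˡ ([]-cong (x Fin.≟ y) (y Fin.≟ x) ≡.sym ≡.sym))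

    B-diagonal : ∀ x → B x x ≈ fromℕ b
    B-diagonal x = 1+x≈y⇒x≈y-1 (sym (trans (*-congˡ ([]-yes (x Fin.≟ x) ≡.refl)) (*-identityʳ a)))

    -- Moving the `- 1#` of `B` to the other side leaves a subtraction-free identity, fit for the
    -- semiring solver, in which only the index `x` survives.
    ∑-B : ∀ {x} → x ∈ full → ∀ (f : Vector Carrier m) → sum (λ c → σ c * (B x c * f c)) ≈ a * f x - sum (λ c → σ c * f c)
    ∑-B {x} x∈full f = x+y≈z⇒x≈z-y (begin
      sum (λ c → σ c * (B x c * f c)) + sum (λ c → σ c * f c)
        ≈⟨ ∑-+ m (λ c → σ c * (B x c * f c)) (λ c → σ c * f c) ⟨
      sum (λ c → σ c * (B x c * f c) + σ c * f c)
        ≈⟨ ∑-cong m (λ c → trans (regroup (σ c) (B x c) (f c))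
             (trans (*-congˡ (*-congʳ ([x-y]+y≈x _ _))) (rearrange (σ c) a [ c Fin.≟ x ] (f c)))) ⟩
      sum (λ c → [ c Fin.≟ x ] * (a * (σ c * f c)))
        ≈⟨ ∑-single m (Fin._≟ x) (λ c → a * (σ c * f c)) ≡.refl (λ eq → eq) ⟩
      a * (σ x * f x)
        ≈⟨ *-congˡ (trans (*-congʳ ([]-yes (x ∈? full) x∈full)) (*-identityˡ _)) ⟩
      a * f x ∎)
      where
      regroup : ∀ p q r → p * (q * r) + p * r ≈ p * ((q + 1#) * r)
      regroup = solve 3 (λ p q r → p :* (q :* r) :+ p :* r := p :* ((q :+ con 1) :* r)) refl
      rearrange : ∀ p q r t → p * ((q * r) * t) ≈ r * (q * (p * t))
      rearrange = solve 4 (λ p q r t → p :* ((q :* r) :* t) := r :* (q :* (p :* t))) refl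

    ∑-B≈0 : ∀ {x} → x ∈ full → sum (λ c → σ c * B x c) ≈ 0#
    ∑-B≈0 {x} x∈full = begin
      sum (λ c → σ c * B x c)            ≈⟨ ∑-cong m (λ c → *-congˡ (*-identityʳ (B x c))) ⟨
      sum (λ c → σ c * (B x c * 1#))     ≈⟨ ∑-B x∈full (λ _ → 1#) ⟩
      a * 1# - sum (λ c → σ c * 1#)      ≈⟨ +-cong (*-identityʳ a) (-‿cong (trans (∑-cong m (λ c → *-identityʳ (σ c))) ∑σ≈a)) ⟩
      a - a                              ≈⟨ -‿inverseʳ a ⟩
      0#                                 ∎

    ∑-BB : ∀ {x y} → x ∈ full → y ∈ full → sum (λ c → σ c * (B x c * B c y)) ≈ a * B x y
    ∑-BB {x} {y} x∈full y∈full = begin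
      sum (λ c → σ c * (B x c * B c y))      ≈⟨ ∑-B x∈full (λ c → B c y) ⟩
      a * B x y - sum (λ c → σ c * B c y)    ≈⟨ +-congˡ (-‿cong (trans (∑-cong m (λ c → *-congˡ (B-sym y c))) (∑-B≈0 y∈full))) ⟩
      a * B x y - 0#                         ≈⟨ trans (+-congˡ -0#≈0#) (+-identityʳ _) ⟩
      a * B x y                              ∎

    -- An entry of `Q` depends only on the classes of its two edges. The factor `κ` divides by `a`
    -- to normalise `B`, and by `s`, the squared norm of the indicator vector of a full class.
    H : Matrix K m m
    H x y = κ * (σ x * (σ y * B x y))

    H-∉ˡ : ∀ {x} → ¬ (x ∈ full) → ∀ y → H x y ≈ 0#
    H-∉ˡ x∉full y = trans (*-congˡ (trans (*-congʳ (σ-∉ x∉full)) (zeroˡ _))) (zeroʳ κ)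

    H-sym : IsSymmetric K H
    H-sym x y = *-congˡ (trans (*-congˡ (*-congˡ (B-sym x y))) (swap (σ y) (σ x) (B x y)))
      where
      swap : ∀ p q r → p * (q * r) ≈ q * (p * r)
      swap = solve 3 (λ p q r → p :* (q :* r) := q :* (p :* r)) refl

    Q : Matrix K size size
    Q e f = H (class e) (class f)

    Q-diagonal : ∀ e → Q e e ≈ κ * (σ (class e) * fromℕ b)
    Q-diagonal e = *-congˡ (begin
      x * (x * B (class e) (class e))     ≈⟨ *-assoc _ _ _ ⟨
      x * x * B (class e) (class e)       ≈⟨ *-cong ([]-idem (class e ∈? full)) (B-diagonal (class e)) ⟩
      x * fromℕ b         ∎)
      where
      x = σ (class e)

    trace-Q : trace Q ≈ fromℕ b
    trace-Q = begin
      trace Q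
        ≈⟨ ∑-cong size (λ e → trans (Q-diagonal e) (rotate κ (σ (class e)) (fromℕ b))) ⟩
      sum (λ e → σ (class e) * (κ * fromℕ b))
        ≈⟨ ∑-*ʳ size (κ * fromℕ b) (λ e → σ (class e)) ⟨
      sum (λ e → σ (class e)) * (κ * fromℕ b)
        ≈⟨ *-congʳ (trans ∑-fullEdges (*-congʳ (reflexive (≡.cong fromℕ ∣full∣≡1+b)))) ⟩
      a * fromℕ s * (κ * fromℕ b)
        ≈⟨ regroup a (fromℕ s) κ (fromℕ b) ⟩
      fromℕ s * a * κ * fromℕ b
        ≈⟨ trans (*-congʳ s*a*κ≈1) (*-identityˡ _) ⟩
      fromℕ b ∎
      where
      rotate : ∀ p q r → p * (q * r) ≈ q * (p * r)
      rotate = solve 3 (λ p q r → p :* (q :* r) := q :* (p :* r)) refl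
      regroup : ∀ p q r t → p * q * (r * t) ≈ q * p * r * t
      regroup = solve 4 (λ p q r t → p :* q :* (r :* t) := q :* p :* r :* t) refl

    -- The common form of the entries of `Q ∙ Q`, where `φ = 1` and `t = s`, and of
    -- `Q ∙ incidence K F`, where `g = 1`, `φ` is incidence with a point and `t = 1`.
    ∑-H : ∀ x (g : Fin m → Carrier) (φ : Subset n → Carrier) t →
      (∀ c → sum (λ i → φ (line c i)) ≈ t) →
      sum (λ e → H x (class e) * (g (class e) * φ (edge e))) ≈
      κ * σ x * sum (λ c → σ c * (B x c * g c)) * t
    ∑-H x g φ t ∑φ≈t = begin
      sum (λ e → H x (class e) * (g (class e) * φ (edge e)))
        ≈⟨ ∑-cong size (λ e → regroup κ (σ x) (σ (class e)) (B x (class e)) (g (class e)) (φ (edge e))) ⟩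
      sum (λ e → κ * σ x * (σ (class e) * (B x (class e) * g (class e)) * φ (edge e)))
        ≈⟨ ∑-*ˡ size (κ * σ x) (λ e → σ (class e) * (B x (class e) * g (class e)) * φ (edge e)) ⟨
      κ * σ x * sum (λ e → σ (class e) * (B x (class e) * g (class e)) * φ (edge e))
        ≈⟨ *-congˡ (∑-fullClasses (λ c → B x c * g c) φ t ∑φ≈t) ⟩
      κ * σ x * (sum (λ c → σ c * (B x c * g c)) * t)
        ≈⟨ *-assoc _ _ _ ⟨
      κ * σ x * sum (λ c → σ c * (B x c * g c)) * t ∎
      where
      regroup : ∀ k p q r u v → k * (p * (q * r)) * (u * v) ≈ k * p * (q * (r * u) * v)
      regroup = solve 6 (λ k p q r u v → k :* (p :* (q :* r)) :* (u :* v) := k :* p :* (q :* (r :* u) :* v)) refl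

    -- Between full classes, summing inside a class gives a factor `s`, and summing over classes
    -- turns the square of `B` into `a * B`; one factor `κ` absorbs `s * a`. In the other cases both
    -- sides vanish.
    QQ≋Q : ∀ e f → (Q ∙ Q) e f ≈ Q e f
    QQ≋Q e f = byCases (x ∈? full) (y ∈? full)
      where
      x = class e
      y = class f
      byCases : Dec (x ∈ full) → Dec (y ∈ full) → (Q ∙ Q) e f ≈ Q e f
      byCases (no x∉full) _ =
        trans (∑-zero size (λ k → trans (*-congʳ (H-∉ˡ x∉full (class k))) (zeroˡ _))) (sym (H-∉ˡ x∉full y))
      byCases _ (no y∉full) =
        trans (∑-zero size (λ k → trans (*-congˡ (trans (H-sym y (class k)) (H-∉ˡ y∉full (class k)))) (zeroʳ _)))
              (sym (trans (H-sym y x) (H-∉ˡ y∉full x)))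
      byCases (yes x∈full) (yes y∈full) = begin
        (Q ∙ Q) e f
          ≈⟨ ∑-cong size (λ k → *-congˡ (*-identityʳ (H (class k) y))) ⟨
        sum (λ k → H x (class k) * (H (class k) y * 1#))
          ≈⟨ ∑-H x (λ c → H c y) (λ _ → 1#) (fromℕ s) (λ _ → ∑-1 s) ⟩
        κ * σ x * sum (λ c → σ c * (B x c * H c y)) * fromℕ s
          ≈⟨ *-congʳ (*-congˡ (trans
               -- `σ c` occurs in both copies of `H`; as an indicator it is idempotent.
               (∑-cong m (λ c → trans (regroup (σ c) (B x c) κ (σ y) (B c y)) (*-congˡ (*-congʳ ([]-idem (c ∈? full))))))
               (trans (sym (∑-*ˡ m (κ * σ y) (λ c → σ c * (B x c * B c y)))) (*-congˡ (∑-BB x∈full y∈full))))) ⟩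
        κ * σ x * (κ * σ y * (a * B x y)) * fromℕ s
          ≈⟨ collect κ (σ x) (σ y) a (B x y) (fromℕ s) ⟩
        fromℕ s * a * κ * Q e f
          ≈⟨ trans (*-congʳ s*a*κ≈1) (*-identityˡ _) ⟩
        Q e f ∎
        where
        regroup : ∀ p q k r t → p * (q * (k * (p * (r * t)))) ≈ k * r * (p * p * (q * t))
        regroup = solve 5 (λ p q k r t → p :* (q :* (k :* (p :* (r :* t)))) := k :* r :* (p :* p :* (q :* t))) refl
        collect : ∀ k p q a r t → k * p * (k * q * (a * r)) * t ≈ t * a * k * (k * (p * (q * r)))
        collect = solve 6 (λ k p q a r t → k :* p :* (k :* q :* (a :* r)) :* t := t :* a :* k :* (k :* (p :* (q :* r)))) refl

    -- Each point lies on exactly one line of every class, so a full class contributes just its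
    -- coefficient from `B`, and these coefficients sum to zero.
    QN≈0 : ∀ e j → (Q ∙ incidence K F) e j ≈ 0#
    QN≈0 e j = byCases (x ∈? full)
      where
      x = class e
      v = element (V⁺ F) j
      v∈points : v ∈ points
      v∈points = V⁺⊆points (element∈ (V⁺ F) j)
      linesThrough-v : ∀ c → sum (λ i → [ v ∈? line c i ]) ≈ 1#
      linesThrough-v c with line-cover c v∈points
      ... | i , v∈i = trans (sym (∑-cong s (λ i → *-identityʳ [ v ∈? line c i ])))
        (∑-single s (λ i → v ∈? line c i) (λ _ → 1#) v∈i (λ v∈j → line-unique v∈j v∈i))
      byCases : Dec (x ∈ full) → (Q ∙ incidence K F) e j ≈ 0#
      byCases (no x∉full) =
        ∑-zero size (λ k → trans (*-congʳ (H-∉ˡ x∉full (class k))) (zeroˡ _))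
      byCases (yes x∈full) = begin
        (Q ∙ incidence K F) e j
          ≈⟨ ∑-cong size (λ k → *-congˡ (*-identityˡ [ v ∈? edge k ])) ⟨
        sum (λ k → H x (class k) * (1# * [ v ∈? edge k ]))
          ≈⟨ ∑-H x (λ _ → 1#) (λ L → [ v ∈? L ]) 1# linesThrough-v ⟩
        κ * σ x * sum (λ c → σ c * (B x c * 1#)) * 1#
          ≈⟨ trans (*-identityʳ _) (*-congˡ (trans (∑-cong m (λ c → *-congˡ (*-identityʳ (B x c)))) (∑-B≈0 x∈full))) ⟩
        κ * σ x * 0#
          ≈⟨ zeroʳ _ ⟩
        0# ∎

    -- The two projectors have traces `rank` and `b`, so the hypothesis says that their traces add
    -- up to the number of edges.
    leverage+Q≈1 : rank K (incidence K F) ℕ.+ b ≡ size →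
                   ∀ e → leverage K F e + Q e e ≈ 1#
    leverage+Q≈1 rank+b≡size =
      complementaryProjectors N (_† K N) Q (†-isMoorePenroseInverse K N) (λ e f → H-sym (class e) (class f)) QQ≋Q QN≈0 (begin
        trace (N ∙ _† K N) + trace Q
          ≈⟨ +-cong (trace-⊡-generalizedInverse N (_† K N) (rank-isRank K N)
               (IsMoorePenroseInverse.AXA≋A (†-isMoorePenroseInverse K N))) trace-Q ⟩
        fromℕ (rank K N) + fromℕ b    ≈⟨ fromℕ-homo-+ (rank K N) b ⟨
        fromℕ (rank K N ℕ.+ b)        ≡⟨ ≡.cong fromℕ rank+b≡size ⟩
        fromℕ size                    ∎)
      where
      N = incidence K F

    leverage-partial : rank K (incidence K F) ℕ.+ b ≡ size →
      ∀ {e} → ¬ (class e ∈ full) → leverage K F e ≈ 1#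
    leverage-partial rank+b≡size {e} e∉full = begin
      leverage K F e           ≈⟨ +-identityʳ _ ⟨
      leverage K F e + 0#      ≈⟨ +-congˡ (H-∉ˡ e∉full (class e)) ⟨
      leverage K F e + Q e e   ≈⟨ leverage+Q≈1 rank+b≡size e ⟩
      1#                       ∎

    leverage-full : rank K (incidence K F) ℕ.+ b ≡ size →
      ∀ {e} → class e ∈ full → leverage K F e ≈ 1# - fromℕ b / (fromℕ s * fromℕ (suc b))
    leverage-full rank+b≡size {e} e∈full = x+y≈z⇒x≈z-y (begin
      leverage K F e + fromℕ b * κ   ≈⟨ +-congˡ (trans (Q-diagonal e) (trans
                                          (*-congˡ (trans (*-congʳ ([]-yes (class e ∈? full) e∈full)) (*-identityˡ _)))
                                          (*-comm _ _))) ⟨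
      leverage K F e + Q e e         ≈⟨ leverage+Q≈1 rank+b≡size e ⟩
      1#                             ∎)

-- Arithmetic linking the value of `R`, the rank and the number of edges.

x-y≡z⇒x≡z+y : ∀ {x y z} → x ℤ.- y ≡ z → x ≡ z ℤ.+ y
x-y≡z⇒x≡z+y {x} {y} ≡.refl = identity x y
  where
  identity : ∀ x y → x ≡ x ℤ.- y ℤ.+ y
  identity = ℤ-Solver.solve-∀

-- Multiplied by 1 + s, the claim becomes d + (1 + s) b ≡ (1 + b) s + p.
rank+nullity : ∀ h b p r {z} → z ≡ suc b ℕ.* (h ℕ.+ b) ℕ.+ p →
               + suc (h ℕ.+ b) ℤ.* + r ℤ.- + (h ℕ.+ b) ℤ.* + z ≡ + (h ℕ.+ p) → r ℕ.+ b ≡ z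
rank+nullity h b p r {z} ≡.refl R≡d = ℕ.*-cancelˡ-≡ _ _ (suc s) (begin
  suc s ℕ.* (r ℕ.+ b)              ≡⟨ ℕ.*-distribˡ-+ (suc s) r b ⟩
  suc s ℕ.* r ℕ.+ suc s ℕ.* b      ≡⟨ ≡.cong (ℕ._+ suc s ℕ.* b) [1+s]r≡d+sz ⟩
  d ℕ.+ s ℕ.* z ℕ.+ suc s ℕ.* b    ≡⟨ identity h b p ⟩
  suc s ℕ.* z                      ∎)
  where
  open ≡.≡-Reasoning
  s d : ℕ
  s = h ℕ.+ b
  d = h ℕ.+ p
  [1+s]r≡d+sz : suc s ℕ.* r ≡ d ℕ.+ s ℕ.* z
  [1+s]r≡d+sz = ℤ.+-injective (begin
    + (suc s ℕ.* r)        ≡⟨ ℤ.pos-* (suc s) r ⟩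
    + suc s ℤ.* + r        ≡⟨ x-y≡z⇒x≡z+y R≡d ⟩
    + d ℤ.+ + s ℤ.* + z    ≡⟨ ≡.cong (λ x → + d ℤ.+ x) (ℤ.pos-* s z) ⟨
    + (d ℕ.+ s ℕ.* z)      ∎)
  identity : ∀ h b p →
    (h ℕ.+ p) ℕ.+ (h ℕ.+ b) ℕ.* (suc b ℕ.* (h ℕ.+ b) ℕ.+ p) ℕ.+ suc (h ℕ.+ b) ℕ.* b ≡
    suc (h ℕ.+ b) ℕ.* (suc b ℕ.* (h ℕ.+ b) ℕ.+ p)
  identity = ℕ-Solver.solve-∀

-- Here `b` is the left nullity and `p` the number of partial-direction lines. With `s` and `d`
-- written as sums, each formula becomes a polynomial identity in `h`, `b` and `p` over `ℤ`.
module RankFormulas (h b p r : ℕ) (r+b≡z : r ℕ.+ b ≡ suc b ℕ.* (h ℕ.+ b) ℕ.+ p) where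

  open ≡.≡-Reasoning

  private
    s d : ℕ
    s = h ℕ.+ b
    d = h ℕ.+ p

  pos-z : + (suc b ℕ.* s ℕ.+ p) ≡ + suc b ℤ.* + s ℤ.+ + p
  pos-z = ≡.cong (ℤ._+ + p) (ℤ.pos-* (suc b) s)

  r≡z-b : + r ≡ + suc b ℤ.* + s ℤ.+ + p ℤ.- + b
  r≡z-b = begin
    + r                                    ≡⟨ identity (+ r) (+ b) ⟩
    + (r ℕ.+ b) ℤ.- + b                    ≡⟨ ≡.cong (λ x → + x ℤ.- + b) r+b≡z ⟩
    + (suc b ℕ.* s ℕ.+ p) ℤ.- + b          ≡⟨ ≡.cong (ℤ._- + b) pos-z ⟩
    + suc b ℤ.* + s ℤ.+ + p ℤ.- + b        ∎
    where
    identity : ∀ r b → r ≡ r ℤ.+ b ℤ.- b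
    identity = ℤ-Solver.solve-∀

  rank-formula : + r ≡ 1ℤ ℤ.+ (+ suc s ℤ.- + h) ℤ.* (+ s ℤ.- 1ℤ) ℤ.+ (+ d ℤ.- + h)
  rank-formula = ≡.trans r≡z-b (identity (+ h) (+ b) (+ p))
    where
    identity : ∀ h b p →
      (1ℤ ℤ.+ b) ℤ.* (h ℤ.+ b) ℤ.+ p ℤ.- b ≡
      1ℤ ℤ.+ (1ℤ ℤ.+ (h ℤ.+ b) ℤ.- h) ℤ.* ((h ℤ.+ b) ℤ.- 1ℤ) ℤ.+ ((h ℤ.+ p) ℤ.- h)
    identity = ℤ-Solver.solve-∀

  corank-formula : + (s ℕ.* s) ℤ.- + r ≡ + h ℤ.* + s ℤ.- + d
  corank-formula = ≡.trans (≡.cong₂ ℤ._-_ (ℤ.pos-* s s) r≡z-b) (identity (+ h) (+ b) (+ p))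
    where
    identity : ∀ h b p →
      (h ℤ.+ b) ℤ.* (h ℤ.+ b) ℤ.- ((1ℤ ℤ.+ b) ℤ.* (h ℤ.+ b) ℤ.+ p ℤ.- b) ≡
      h ℤ.* (h ℤ.+ b) ℤ.- (h ℤ.+ p)
    identity = ℤ-Solver.solve-∀

  excess-formula : + suc s ℤ.* + (s ℕ.* s) ℤ.- + s ℤ.* + (suc b ℕ.* s ℕ.+ p) ≡
                   + s ℤ.* (+ suc s ℤ.* + h ℤ.- + d)
  excess-formula = ≡.trans
    (≡.cong₂ (λ x y → + suc s ℤ.* x ℤ.- + s ℤ.* y) (ℤ.pos-* s s) pos-z)
    (identity (+ h) (+ b) (+ p))
    where
    identity : ∀ h b p →
      (1ℤ ℤ.+ (h ℤ.+ b)) ℤ.* ((h ℤ.+ b) ℤ.* (h ℤ.+ b)) ℤ.- (h ℤ.+ b) ℤ.* ((1ℤ ℤ.+ b) ℤ.* (h ℤ.+ b) ℤ.+ p) ≡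
      (h ℤ.+ b) ℤ.* ((1ℤ ℤ.+ (h ℤ.+ b)) ℤ.* h ℤ.- (h ℤ.+ p))
    identity = ℤ-Solver.solve-∀

-- Vertex count, rank and leverages of a hypergraph in an affine plane.

corollary6p1 :
    ∀ {c ℓ₁ ℓ₂} (K : OrderedField c ℓ₁ ℓ₂) →
    ∀ {n} (F : Hypergraph n) (s d h : ℕ) →
    let open OrderedField K
        open Hypergraph F
    in
    0 ℕ.< size →
    IsConnected F →
    IsLinear F →
    IsUniform F s →
    IsCograph (LineGraph F) →
    R K F s ≡ + d →
    0 ℕ.< d →
    d ℕ.≤ s ∸ 1 →
    Comp s d →
    (Π : AffinePlane n s) →
    1 ℕ.≤ h →
    h ℕ.≤ d →
    F ⊆ᴸ Π →
    (full : Subset (suc s)) →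
    ∣ full ∣ ≡ suc s ∸ h →
    (∀ c → c ∈ full → ContainsClass F Π c) →
    ∣ edgesWithClassIn F Π (∁ full) ∣ ≡ d ∸ h →
    ∣ V ∣ ≡ s ℕ.* s ×
    + rank K (incidence K F) ≡ 1ℤ ℤ.+ (+ suc s ℤ.- + h) ℤ.* (+ s ℤ.- 1ℤ) ℤ.+ (+ d ℤ.- + h) ×
    C K F ≡ + h ℤ.* + s ℤ.- + d ×
    + suc s ℤ.* + ∣ V ∣ ℤ.- + s ℤ.* + size ≡ + s ℤ.* (+ suc s ℤ.* + h ℤ.- + d) ×
    (∀ e → LineWithClassIn Π (∁ full) (edge e) → leverage K F e ≈ 1#) ×
    (∀ e → LineWithClassIn Π full (edge e) →
      leverage K F e ≈ 1# - (fromℕ s - fromℕ h) / (fromℕ s * (fromℕ (suc s) - fromℕ h)))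
corollary6p1 K F s d h _ (_ , V⊆V⁺) _ _ _ R≡d 0<d d≤s-1 _ Π _ h≤d F⊆Π full ∣full∣≡ contains ∣partial∣≡
  -- The witnesses are `p = d - h` and `b = s - h`, available since `h ≤ d ≤ s ∸ 1 ≤ s`; matching on
  -- `≡.refl` replaces `d` and `s` by sums.
  with ℕ.m≤n⇒∃[o]m+o≡n h≤d
     | ℕ.m≤n⇒∃[o]m+o≡n (ℕ.≤-trans h≤d (ℕ.≤-trans d≤s-1 (ℕ.m∸n≤m s 1)))
... | p , ≡.refl | b , ≡.refl =
    ∣V∣≡s*s
  , rank-formula
  , ≡.trans (≡.cong (λ S → + ∣ S ∣ ℤ.- + rank K N) V⁺≡points)
      (≡.trans (≡.cong (λ k → + k ℤ.- + rank K N) (Net.points-size Π)) corank-formula)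
  , ≡.trans (≡.cong₂ (λ v z → + suc s ℤ.* + v ℤ.- + s ℤ.* + z) ∣V∣≡s*s size≡) excess-formula
  , (λ e partial → leverage-partial rank+b≡size (x∈∁p⇒x∉p (lineWithClassIn⇒class∈ partial)))
  , (λ e isFull → trans (leverage-full rank+b≡size (lineWithClassIn⇒class∈ isFull))
      (+-congˡ (-‿cong (sym (*-cong s-h≈b (⁻¹-cong (*-congˡ 1+s-h≈1+b)))))))
  where
  open OrderedField K
  open Hypergraph F
  open FieldProperties K
  N = incidence K F
  1<s : 1 ℕ.< s
  -- For `s ≤ 1` the bound `s ∸ 1` would be 0, against `0 < d`.
  1<s = ℕ.≰⇒> (λ s≤1 → ℕ.<⇒≱ (ℕ.<-≤-trans 0<d d≤s-1) (ℕ.∸-monoˡ-≤ 1 s≤1))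
  open FullClasses K F Π 1<s F⊆Π full contains
  ∣full∣≡1+b : ∣ full ∣ ≡ suc b
  ∣full∣≡1+b = ≡.trans ∣full∣≡ (≡.trans (ℕ.+-∸-assoc 1 (ℕ.m≤m+n h b)) (≡.cong suc (ℕ.m+n∸m≡n h b)))
  open NullProjector b ∣full∣≡1+b
  size≡ : size ≡ suc b ℕ.* s ℕ.+ p
  size≡ = ≡.trans size-count (≡.cong₂ ℕ._+_ (≡.cong (ℕ._* s) ∣full∣≡1+b)
            (≡.trans ∣partial∣≡ (ℕ.m+n∸m≡n h p)))
  rank+b≡size : rank K N ℕ.+ b ≡ size
  -- Once the edges are counted, the value of `R` leaves only one possible rank.
  rank+b≡size = rank+nullity h b p (rank K N) size≡ R≡d
  open RankFormulas h b p (rank K N) (≡.trans rank+b≡size size≡)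
  -- There are `suc b` full classes, hence at least one.
  fullClass : Nonempty full
  fullClass with nonempty? full
  ... | yes ne = ne
  ... | no  em = contradiction (≡.trans (≡.sym ∣full∣≡1+b)
                   (≡.trans (≡.cong ∣_∣ (Empty-unique em)) (∣⊥∣≡0 (suc s)))) ℕ.1+n≢0
  V⁺≡points : V⁺ F ≡ Net.points Π
  V⁺≡points = ⊆-antisym V⁺⊆points (points⊆V⁺ (proj₂ fullClass))
  V⁺⊆V : V⁺ F ⊆ V
  V⁺⊆V v∈V⁺ with ∈-select⁻ (λ v → Fin.any? (λ e → v ∈? edge e)) v∈V⁺
  ... | e , v∈e = edge⊆V e v∈e
  ∣V∣≡s*s : ∣ V ∣ ≡ s ℕ.* s
  -- Connectedness excludes isolated vertices, so `V` coincides with `V⁺ F` and hence with the point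
  -- set of the plane.
  ∣V∣≡s*s = ≡.trans (≡.cong ∣_∣ (≡.trans (⊆-antisym V⊆V⁺ V⁺⊆V) V⁺≡points)) (Net.points-size Π)
  s-h≈b : fromℕ s - fromℕ h ≈ fromℕ b
  s-h≈b = fromℕ-∸ h b ≡.refl
  1+s-h≈1+b : fromℕ (suc s) - fromℕ h ≈ fromℕ (suc b)
  1+s-h≈1+b = fromℕ-∸ h (suc b) (ℕ.+-suc h b)
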